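{- Let $m$ be a positive integer and $j\in\{1,2\}$. Then $r(T_m',T_{m+1}^j)=2m-4$ if $m$ is odd and $m\ge 9$, and $r(T_m',T_{m+1}^j)=2m-5$ if $m$ is even and $m\ge 16$. Furthermore, if $n$ is a positive integer, $m\ge 7$, $n\ge \max\{m+2,19-m\}$ and $m-1\nmid (n-4)$, then $r(T_m',T_n^j)=m+n-5$.
   Context: All graphs are finite and simple. For graphs $G_1,G_2$, the Ramsey number $r(G_1,G_2)$ is the smallest positive integer $N$ such that for every graph $G$ on $N$ vertices, either $G$ contains a subgraph isomorphic to $G_1$ or the complement $\overline G$ contains a subgraph isomorphic to $G_2$. $T_m'$ is the unique (up to isomorphism) tree on $m$ vertices with maximum degree $m-2$. $T_s^1$ is the tree with vertex set $\{v_0,\ldots,v_{s-1}\}$ and edge set $\{v_0v_1,\ldots,v_0v_{s-3},v_{s-4}v_{s-2},v_{s-3}v_{s-1}\}$; $T_s^2$ is the tree with the same vertex set and edge set $\{v_0v_1,\ldots,v_0v_{s-3},v_{s-3}v_{s-2},v_{s-3}v_{s-1}\}$. -}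

module Defs where

open import Data.Nat using (ℕ; zero; suc; _+_; _*_; _∸_; _≤_; _<_; _≡ᵇ_; _≤ᵇ_)
open import Data.Bool using (Bool; true; false; _∧_; _∨_; not)
open import Data.Bool.Properties using (∨-comm)
open import Data.Fin using (Fin; toℕ; _≟_)
open import Data.Fin.Properties using ()
open import Data.Product using (Σ; _×_; _,_)
open import Relation.Nullary using (¬_; yes; no)
open import Relation.Nullary.Decidable using (⌊_⌋)
open import Relation.Binary.PropositionalEquality using (_≡_; refl; sym; cong₂)
open import Function.Definitions using (Injective)

record Graph (n : ℕ) : Set where
  field
    adj   : Fin n → Fin n → Bool
    adj-sym : ∀ i j → adj i j ≡ adj j i
    adj-irr : ∀ i → adj i i ≡ false
open Graph public

private
  eqb : ∀ {n} → Fin n → Fin n → Bool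
  eqb i j = ⌊ i ≟ j ⌋

  eqb-sym : ∀ {n} (i j : Fin n) → eqb i j ≡ eqb j i
  eqb-sym i j with i ≟ j | j ≟ i
  ... | yes _ | yes _ = refl
  ... | no _  | no _  = refl
  ... | yes p | no q  = Data.Empty.⊥-elim (q (sym p))
    where import Data.Empty
  ... | no p  | yes q = Data.Empty.⊥-elim (p (sym q))
    where import Data.Empty

  eqb-refl : ∀ {n} (i : Fin n) → eqb i i ≡ true
  eqb-refl i with i ≟ i
  ... | yes _ = refl
  ... | no p = Data.Empty.⊥-elim (p refl)
    where import Data.Empty

  and-not-true : ∀ b → b ∧ not true ≡ false
  and-not-true false = refl
  and-not-true true = refl

complement : ∀ {n} → Graph n → Graph n
complement G = record
  { adj = λ i j → not (adj G i j) ∧ not (eqb i j)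
  ; adj-sym = λ i j → cong₂ (λ a b → not a ∧ not b) (adj-sym G i j) (eqb-sym i j)
  ; adj-irr = λ i → Relation.Binary.PropositionalEquality.trans
      (Relation.Binary.PropositionalEquality.cong (λ b → not (adj G i i) ∧ not b) (eqb-refl i))
      (and-not-true (not (adj G i i)))
  }

mkGraph : (n : ℕ) → (ℕ → ℕ → Bool) → Graph n
mkGraph n e = record
  { adj = λ i j → (e (toℕ i) (toℕ j) ∨ e (toℕ j) (toℕ i)) ∧ not (eqb i j)
  ; adj-sym = λ i j → cong₂ (λ a b → a ∧ not b) (∨-comm (e (toℕ i) (toℕ j)) (e (toℕ j) (toℕ i))) (eqb-sym i j)
  ; adj-irr = λ i → Relation.Binary.PropositionalEquality.trans
      (Relation.Binary.PropositionalEquality.cong (λ b → (e (toℕ i) (toℕ i) ∨ e (toℕ i) (toℕ i)) ∧ not b) (eqb-refl i))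
      (and-not-true _)
  }

_⊆G_ : ∀ {k n} → Graph k → Graph n → Set
_⊆G_ {k} {n} H G = Σ (Fin k → Fin n) λ f →
  Injective _≡_ _≡_ f × (∀ a b → adj H a b ≡ true → adj G (f a) (f b) ≡ true)

Arrows : ∀ {k l} → ℕ → Graph k → Graph l → Set
Arrows N G₁ G₂ = (G : Graph N) → (G₁ ⊆G G) Data.Sum.⊎ (G₂ ⊆G complement G)
  where import Data.Sum

RamseyNumber : ∀ {k l} → Graph k → Graph l → ℕ → Set
RamseyNumber G₁ G₂ N =
  1 ≤ N × Arrows N G₁ G₂ × (∀ M → 1 ≤ M → M < N → ¬ Arrows M G₁ G₂)

starE : ℕ → ℕ → ℕ → Bool
starE t a b = (a ≡ᵇ 0) ∧ (1 ≤ᵇ b) ∧ (b ≤ᵇ t)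

-- T'_m : vertices v₀…v_{m-1}, edges v₀v₁,…,v₀v_{m-2}, v₁v_{m-1}
-- (the tree on m vertices with maximum degree m-2).
T′ : (m : ℕ) → Graph m
T′ m = mkGraph m λ a b → starE (m ∸ 2) a b ∨ ((a ≡ᵇ 1) ∧ (b ≡ᵇ m ∸ 1))

T¹ : (s : ℕ) → Graph s
T¹ s = mkGraph s λ a b → starE (s ∸ 3) a b
  ∨ ((a ≡ᵇ s ∸ 4) ∧ (b ≡ᵇ s ∸ 2)) ∨ ((a ≡ᵇ s ∸ 3) ∧ (b ≡ᵇ s ∸ 1))

T² : (s : ℕ) → Graph s
T² s = mkGraph s λ a b → starE (s ∸ 3) a b
  ∨ ((a ≡ᵇ s ∸ 3) ∧ (b ≡ᵇ s ∸ 2)) ∨ ((a ≡ᵇ s ∸ 3) ∧ (b ≡ᵇ s ∸ 1))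

-- T^j_s for j ∈ {1,2} (only used with j = 1 or j = 2)
T : ℕ → (s : ℕ) → Graph s
T 1 s = T¹ s
T _ s = T² s

Odd : ℕ → Set
Odd m = Σ ℕ λ k → m ≡ suc (2 * k)

Even : ℕ → Set
Even m = Σ ℕ λ k → m ≡ 2 * k

{-# OPTIONS --safe #-}
-- Write m = d + 3 and n = k + 5, and let H be the complement of G.
--
-- Upper bound. If G contains no T′_m, a vertex of degree at least m − 1 is the centre of a star component, and the
-- closed neighbourhood of a vertex of degree m − 2 is a component. The leaves of a star are joined in H to everything
-- but the centre, so H contains T^j_n. In the second case H contains all edges between the component and the rest, and
-- T^j_n can be centred at any vertex of H-degree at least n − 3; if there is none, G is a disjoint union of copies of
-- K_{m−1}, against the divisibility hypothesis. If all degrees in G are at most m − 3, take v of H-degree at least n − 3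
-- (by the handshake lemma when m is even and n = m + 1) and count the H-edges between N_H(v) and N_G(v).
--
-- Lower bound. A graph with degrees at most m − 3 whose complement has degrees at most n − 4 contains no T′_m, and its
-- complement no T^j_n. A circulant graph or the complement of one serves; when the parities forbid a regular graph,
-- the disjoint union of K_{m−1} and a circulant graph does.
module Submission where

open import Defs
open import Data.Nat using (ℕ; zero; suc; _+_; _*_; _∸_; ∣_-_∣; _≤_; _<_; z≤n; s≤s; s≤s⁻¹; _≡ᵇ_; _≤ᵇ_)
open import Data.Nat.Properties renaming (_≟_ to _≟ℕ_; suc-injective to ℕ-suc-injective)
open import Data.Bool as Bool using (Bool; true; false; _∧_; _∨_; not)
open import Data.Bool.Properties using (⇔→≡; ∧-identityʳ; T-≡)
open import Data.Fin using (Fin; zero; suc; toℕ; inject≤; splitAt; _↑ˡ_; _↑ʳ_; _≟_)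
open import Data.Fin.Patterns using (0F; 1F; 2F; 3F)
open import Data.Fin.Properties using (inject≤-injective; toℕ-inject≤; toℕ-↑ˡ; splitAt-↑ˡ; any?; suc-injective; toℕ-injective; toℕ-↑ʳ; splitAt-↑ʳ; splitAt⁻¹-↑ˡ; splitAt⁻¹-↑ʳ; toℕ<n)
open import Data.Nat.Divisibility using (_∣_; divides; ∣m∣n⇒∣m+n; ∣m+n∣m⇒∣n; _∣0; m∣m*n; ∣-refl)
import Data.Vec.Functional as V
open import Data.List using (List; []; _∷_; length)
open import Data.Unit using (⊤; tt)
open import Data.Product using (∃; _×_; _,_; proj₁; proj₂)
open import Data.Sum as Sum using (_⊎_; inj₁; inj₂)
open import Data.Empty using (⊥; ⊥-elim)
open import Relation.Nullary using (¬_; yes; no; contradiction)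
open import Relation.Nullary.Decidable using (toSum; _×-dec_; ¬?; ⌊_⌋)
open import Relation.Binary.PropositionalEquality
open import Function using (_∘_; case_of_; Equivalence; mk⇔)
open import Function.Definitions using (Injective)
open import Data.Nat.Tactic.RingSolver using (solve; solve-∀)
open import Algebra.Properties.Semiring.Sum +-*-semiring
  using (sum; sum-cong-≗; ∑-distrib-+; ∑-comm; *-distribʳ-sum)

-- Derives a ≤ b from (a sum of) linear hypotheses x ≤ y; s is the slack, and eq a semiring identity.
linear : ∀ {x y a b} s → x ≤ y → a + y + s ≡ b + x → a ≤ b
linear {x} {y} {a} {b} s x≤y eq = +-cancelʳ-≤ x a b (begin
  a + x      ≤⟨ +-monoʳ-≤ a x≤y ⟩
  a + y      ≤⟨ m≤m+n (a + y) s ⟩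
  a + y + s  ≡⟨ eq ⟩
  b + x      ∎)
  where open ≤-Reasoning

true≢false : ∀ {b} → b ≡ true → b ≡ false → ⊥
true≢false refl ()

not-true : ∀ {b} → not b ≡ true → b ≡ true → ⊥
not-true () refl

bool-cases : ∀ b → b ≡ true ⊎ b ≡ false
bool-cases true  = inj₁ refl
bool-cases false = inj₂ refl

∧-split : ∀ {a b} → a ∧ b ≡ true → a ≡ true × b ≡ true
∧-split {true} {true} refl = refl , refl

∨-split : ∀ {a b} → a ∨ b ≡ true → a ≡ true ⊎ b ≡ true
∨-split {true}  _  = inj₁ refl
∨-split {false} eq = inj₂ eq

-- Counting with Boolean predicates on finite sets.

⟦_⟧ : Bool → ℕ
⟦ true ⟧  = 1
⟦ false ⟧ = 0

Pred : ℕ → Set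
Pred n = Fin n → Bool

count : ∀ {n} → Pred n → ℕ
count P = sum (λ u → ⟦ P u ⟧)

sum-mono : ∀ {n} {f g : Fin n → ℕ} → (∀ i → f i ≤ g i) → sum f ≤ sum g
sum-mono {zero}  f≤g = z≤n
sum-mono {suc n} f≤g = +-mono-≤ (f≤g zero) (sum-mono (f≤g ∘ suc))

sum-const : ∀ n c → sum {n} (λ _ → c) ≡ n * c
sum-const zero    c = refl
sum-const (suc n) c = cong (c +_) (sum-const n c)

sum-mono-+ : ∀ {n} {f g h : Fin n → ℕ} → (∀ i → f i ≤ g i + h i) → sum f ≤ sum g + sum h
sum-mono-+ {g = g} {h} f≤g+h = ≤-trans (sum-mono f≤g+h) (≤-reflexive (∑-distrib-+ g h))

sum-<-witness : ∀ {n} {f g : Fin n → ℕ} → sum f < sum g → ∃ λ i → f i < g i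
sum-<-witness {suc n} {f} {g} f<g with <-≤-connex (f zero) (g zero)
... | inj₁ f₀<g₀ = zero , f₀<g₀
... | inj₂ g₀≤f₀ =
  let (i , fi<gi) = sum-<-witness {f = f ∘ suc} (+-cancelˡ-< (f zero) _ _ (<-≤-trans f<g (+-monoˡ-≤ _ g₀≤f₀)))
  in suc i , fi<gi

⟦⟧-mono : ∀ {a b} → (a ≡ true → b ≡ true) → ⟦ a ⟧ ≤ ⟦ b ⟧
⟦⟧-mono {false}         _ = z≤n
⟦⟧-mono {true}  {true}  _ = ≤-refl
⟦⟧-mono {true}  {false} f with () ← f refl

count-mono : ∀ {n} (P Q : Pred n) → (∀ u → P u ≡ true → Q u ≡ true) → count P ≤ count Q
count-mono P Q P⊆Q = sum-mono λ u → ⟦⟧-mono (P⊆Q u)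

count-witness : ∀ {n} (P : Pred n) → 0 < count P → ∃ λ u → P u ≡ true
count-witness {n} P 0<P with sum-<-witness {f = λ _ → 0} (subst (_< count P) (sym (trans (sum-const n 0) (*-zeroʳ n))) 0<P)
... | u , 0<Pu with P u in eq
...   | true = u , eq

≟-refl : ∀ {n} (i : Fin n) → ⌊ i ≟ i ⌋ ≡ true
≟-refl i with i ≟ i
... | yes _ = refl
... | no i≢i = ⊥-elim (i≢i refl)

≢-≟ : ∀ {n} {i j : Fin n} → i ≢ j → ⌊ i ≟ j ⌋ ≡ false
≢-≟ {i = i} {j} i≢j with i ≟ j
... | yes i≡j = ⊥-elim (i≢j i≡j)
... | no _ = refl

≟-suc : ∀ {n} (i j : Fin n) → ⌊ suc i ≟ suc j ⌋ ≡ ⌊ i ≟ j ⌋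
≟-suc i j with i ≟ j
... | yes _ = refl
... | no _  = refl

count-≟ : ∀ {n} (x : Fin n) → count (λ u → ⌊ u ≟ x ⌋) ≡ 1
count-≟ {suc n} zero    = cong suc (trans (sum-const n 0) (*-zeroʳ n))
count-≟ {suc n} (suc x) = trans (sum-cong-≗ λ u → cong ⟦_⟧ (≟-suc u x)) (count-≟ x)

infixl 6 _∖_
_∖_ : ∀ {n} → Pred n → Fin n → Pred n
(P ∖ x) u = P u ∧ not ⌊ u ≟ x ⌋

∖-intro : ∀ {n} (P : Pred n) {x u} → P u ≡ true → u ≢ x → (P ∖ x) u ≡ true
∖-intro P Pu u≢x rewrite Pu | ≢-≟ u≢x = refl

∖-elim : ∀ {n} (P : Pred n) {x u} → (P ∖ x) u ≡ true → P u ≡ true × u ≢ x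
∖-elim P {x} {u} eq = proj₁ Pu∧u≢x , λ { refl → not-true (proj₂ Pu∧u≢x) (≟-refl u) }
  where Pu∧u≢x = ∧-split {P u} eq

count-∖ : ∀ {n} (P : Pred n) x → count P ≤ suc (count (P ∖ x))
count-∖ P x = ≤-trans (sum-mono-+ pointwise)
  (≤-reflexive (trans (cong (count (P ∖ x) +_) (count-≟ x)) (+-comm _ 1)))
  where
  pointwise : ∀ u → ⟦ P u ⟧ ≤ ⟦ (P ∖ x) u ⟧ + ⟦ ⌊ u ≟ x ⌋ ⟧
  pointwise u with P u | u ≟ x
  ... | false | _     = z≤n
  ... | true  | yes _ = ≤-refl
  ... | true  | no _  = ≤-refl

count-∖-∈ : ∀ {n} (P : Pred n) {x} → P x ≡ true → suc (count (P ∖ x)) ≤ count P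
count-∖-∈ P {x} Px = ≤-trans
  (≤-reflexive (trans (+-comm 1 _) (trans (cong (count (P ∖ x) +_) (sym (count-≟ x)))
    (sym (∑-distrib-+ (λ u → ⟦ (P ∖ x) u ⟧) (λ u → ⟦ ⌊ u ≟ x ⌋ ⟧))))))
  (sum-mono pointwise)
  where
  pointwise : ∀ u → ⟦ (P ∖ x) u ⟧ + ⟦ ⌊ u ≟ x ⌋ ⟧ ≤ ⟦ P u ⟧
  pointwise u with u ≟ x
  ... | yes refl rewrite Px = ≤-refl
  ... | no _ rewrite ∧-identityʳ (P u) | +-identityʳ ⟦ P u ⟧ = ≤-refl

count-∖-∉ : ∀ {n} (P : Pred n) {x} → P x ≡ false → count P ≤ count (P ∖ x)
count-∖-∉ P {x} Px = count-mono P (P ∖ x) λ u Pu → ∖-intro P Pu λ { refl → true≢false Pu Px }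

count-not : ∀ {n} (P : Pred n) → count P + count (not ∘ P) ≡ n
count-not {n} P = trans (sym (∑-distrib-+ (⟦_⟧ ∘ P) (⟦_⟧ ∘ not ∘ P)))
  (trans (sum-cong-≗ pointwise) (trans (sum-const n 1) (*-identityʳ n)))
  where
  pointwise : ∀ u → ⟦ P u ⟧ + ⟦ not (P u) ⟧ ≡ 1
  pointwise u with P u
  ... | true  = refl
  ... | false = refl

-- Choosing vertices outside a given list.

Avoids : ∀ {n} → List (Fin n) → Fin n → Set
Avoids []       u = ⊤
Avoids (x ∷ xs) u = u ≢ x × Avoids xs u

pick : ∀ {n} (P : Pred n) xs → length xs < count P → ∃ λ u → P u ≡ true × Avoids xs u
pick P []       0<P = let (u , Pu) = count-witness P 0<P in u , Pu , tt
pick P (x ∷ xs) l<P =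
  let (u , P∖xu , avoids) = pick (P ∖ x) xs (s≤s⁻¹ (≤-trans l<P (count-∖ P x)))
      (Pu , u≢x) = ∖-elim P P∖xu
  in u , Pu , (u≢x , avoids)

pick₂ : ∀ {n} (P : Pred n) xs → suc (length xs) < count P →
  ∃ λ u → ∃ λ w → P u ≡ true × P w ≡ true × u ≢ w × Avoids xs u × Avoids xs w
pick₂ P xs l<P =
  let (u , Pu , u∉xs) = pick P xs (≤-trans (n≤1+n _) l<P)
      (w , Pw , w∉u∷xs) = pick P (u ∷ xs) l<P
  in u , w , Pu , Pw , proj₁ w∉u∷xs ∘ sym , u∉xs , proj₂ w∉u∷xs

cons-injective : ∀ {k} {A : Set} {x : A} {f : Fin k → A} → (∀ i → f i ≢ x) →
  Injective _≡_ _≡_ f → Injective _≡_ _≡_ (x V.∷ f)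
cons-injective x∉ inj {zero}  {zero}  _  = refl
cons-injective x∉ inj {zero}  {suc j} eq = ⊥-elim (x∉ j (sym eq))
cons-injective x∉ inj {suc i} {zero}  eq = ⊥-elim (x∉ i eq)
cons-injective x∉ inj {suc i} {suc j} eq = cong suc (inj eq)

-- Greedy choice: each chosen vertex joins the list to be avoided while `k` drops by one, so
-- `length xs + k` is invariant.
select : ∀ {n} k (P : Pred n) xs → length xs + k ≤ count P →
  ∃ λ (f : Fin k → Fin n) → Injective _≡_ _≡_ f × (∀ i → P (f i) ≡ true × Avoids xs (f i))
select zero    P xs _  = (λ ()) , (λ {}) , λ ()
select (suc k) P xs le =
  let le′ = ≤-trans (≤-reflexive (sym (+-suc (length xs) k))) le
      (u , Pu , u∉xs) = pick P xs (≤-trans (s≤s (m≤m+n _ k)) le′)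
      (f , inj , good) = select k P (u ∷ xs) le′
  in (u V.∷ f)
   , cons-injective (λ i → proj₁ (proj₂ (good i))) inj
   , λ { zero → Pu , u∉xs
       ; (suc i) → proj₁ (good i) , proj₂ (proj₂ (good i)) }

injection-count : ∀ {k n} (P : Pred n) (f : Fin k → Fin n) → Injective _≡_ _≡_ f →
  (∀ i → P (f i) ≡ true) → k ≤ count P
injection-count {zero}  P f inj Pf = z≤n
injection-count {suc k} P f inj Pf = ≤-trans
  (s≤s (injection-count (P ∖ f zero) (f ∘ suc) (suc-injective ∘ inj)
    (λ i → ∖-intro P (Pf (suc i)) (λ eq → case inj eq of λ ()))))
  (count-∖-∈ P (Pf zero))

-- Degrees in a graph and in its complement.

deg : ∀ {n} → Graph n → Fin n → ℕ
deg G v = count (adj G v)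

co-intro : ∀ {n} (G : Graph n) {x y} → x ≢ y → adj G x y ≡ false → adj (complement G) x y ≡ true
co-intro G x≢y eq rewrite eq | ≢-≟ x≢y = refl

co-elim : ∀ {n} (G : Graph n) {x y} → adj (complement G) x y ≡ true → adj G x y ≡ false
co-elim G {x} {y} eq with adj G x y
... | false = refl

co-false : ∀ {n} (G : Graph n) {x y} → x ≢ y → adj (complement G) x y ≡ false → adj G x y ≡ true
co-false G {x} {y} x≢y eq with adj G x y | x ≟ y
... | true  | _     = refl
... | false | yes e = ⊥-elim (x≢y e)

adj-≢ : ∀ {n} (G : Graph n) {x y} → adj G x y ≡ true → x ≢ y
adj-≢ G {x} eq refl = true≢false eq (adj-irr G x)

adj-swap : ∀ {n} (G : Graph n) {x y b} → adj G x y ≡ b → adj G y x ≡ b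
adj-swap G {x} {y} eq = trans (adj-sym G y x) eq

deg-complement : ∀ {n} (G : Graph n) v → suc (deg G v + deg (complement G) v) ≡ n
deg-complement {n} G v = begin
  suc (deg G v + deg (complement G) v)                                  ≡⟨ +-comm 1 _ ⟩
  deg G v + deg (complement G) v + 1                                    ≡⟨ cong (deg G v + deg (complement G) v +_) (count-≟ v) ⟨
  deg G v + deg (complement G) v + count (λ u → ⌊ u ≟ v ⌋)              ≡⟨ cong (_+ count (λ u → ⌊ u ≟ v ⌋)) (∑-distrib-+ (⟦_⟧ ∘ adj G v) (⟦_⟧ ∘ adj (complement G) v)) ⟨
  sum (λ u → ⟦ adj G v u ⟧ + ⟦ adj (complement G) v u ⟧) + count (λ u → ⌊ u ≟ v ⌋)  ≡⟨ ∑-distrib-+ _ (λ u → ⟦ ⌊ u ≟ v ⌋ ⟧) ⟨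
  sum (λ u → ⟦ adj G v u ⟧ + ⟦ adj (complement G) v u ⟧ + ⟦ ⌊ u ≟ v ⌋ ⟧)  ≡⟨ sum-cong-≗ pointwise ⟩
  sum {n} (λ _ → 1)                                                     ≡⟨ sum-const n 1 ⟩
  n * 1                                                                 ≡⟨ *-identityʳ n ⟩
  n                                                                     ∎
  where
  open ≡-Reasoning
  pointwise : ∀ u → ⟦ adj G v u ⟧ + ⟦ adj (complement G) v u ⟧ + ⟦ ⌊ u ≟ v ⌋ ⟧ ≡ 1
  pointwise u with u ≟ v
  ... | yes refl rewrite adj-irr G u | ≟-refl u = refl
  ... | no u≢v rewrite ≢-≟ (u≢v ∘ sym) with adj G v u
  ...   | true  = refl
  ...   | false = refl

-- Edge relations and embeddings of the trees.

≡ᵇ-sound : ∀ m n → (m ≡ᵇ n) ≡ true → m ≡ n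
≡ᵇ-sound m n eq = ≡ᵇ⇒≡ m n (Equivalence.from T-≡ eq)

≡ᵇ-complete : ∀ {m n} → m ≡ n → (m ≡ᵇ n) ≡ true
≡ᵇ-complete {m} {n} eq = Equivalence.to T-≡ (≡⇒≡ᵇ m n eq)

≤ᵇ-sound : ∀ m n → (m ≤ᵇ n) ≡ true → m ≤ n
≤ᵇ-sound m n eq = ≤ᵇ⇒≤ m n (Equivalence.from T-≡ eq)

≤ᵇ-complete : ∀ {m n} → m ≤ n → (m ≤ᵇ n) ≡ true
≤ᵇ-complete m≤n = Equivalence.to T-≡ (≤⇒≤ᵇ m≤n)

append-injective : ∀ {k l} {A : Set} {f : Fin k → A} {g : Fin l → A} →
  Injective _≡_ _≡_ f → Injective _≡_ _≡_ g → (∀ i j → f i ≢ g j) → Injective _≡_ _≡_ (f V.++ g)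
append-injective {k} {l} f-inj g-inj f≢g {i} {j} eq with splitAt k {l} i in eqᵢ | splitAt k {l} j in eqⱼ
... | inj₁ i′ | inj₁ j′ = trans (sym (splitAt⁻¹-↑ˡ eqᵢ)) (trans (cong (_↑ˡ l) (f-inj eq)) (splitAt⁻¹-↑ˡ eqⱼ))
... | inj₁ i′ | inj₂ j′ = ⊥-elim (f≢g i′ j′ eq)
... | inj₂ i′ | inj₁ j′ = ⊥-elim (f≢g j′ i′ (sym eq))
... | inj₂ i′ | inj₂ j′ = trans (sym (splitAt⁻¹-↑ʳ eqᵢ)) (trans (cong (k ↑ʳ_) (g-inj eq)) (splitAt⁻¹-↑ʳ eqⱼ))

append-at : ∀ {k l} {A : Set} (f : Fin k → A) (g : Fin l → A) i c → toℕ i ≡ k + toℕ c → (f V.++ g) i ≡ g c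
append-at {k} f g i c eq rewrite toℕ-injective {i = i} {k ↑ʳ c} (trans eq (sym (toℕ-↑ʳ k c))) | splitAt-↑ʳ k _ c = refl

append-all : ∀ {k l} {A : Set} {f : Fin k → A} {g : Fin l → A} (Q : A → Set) →
  (∀ i → Q (f i)) → (∀ j → Q (g j)) → ∀ i → Q ((f V.++ g) i)
append-all {k} Q Qf Qg i with splitAt k i
... | inj₁ i′ = Qf i′
... | inj₂ j′ = Qg j′

-- Names for the edge relations inside `T′`, `T¹` and `T²`, so that each tree is definitionally a
-- `mkGraph` of a relation that can be passed on.
E′ E¹ E² : ℕ → ℕ → ℕ → Bool
E′ m a b = starE (m ∸ 2) a b ∨ ((a ≡ᵇ 1) ∧ (b ≡ᵇ m ∸ 1))
E¹ s a b = starE (s ∸ 3) a b ∨ ((a ≡ᵇ s ∸ 4) ∧ (b ≡ᵇ s ∸ 2)) ∨ ((a ≡ᵇ s ∸ 3) ∧ (b ≡ᵇ s ∸ 1))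
E² s a b = starE (s ∸ 3) a b ∨ ((a ≡ᵇ s ∸ 3) ∧ (b ≡ᵇ s ∸ 2)) ∨ ((a ≡ᵇ s ∸ 3) ∧ (b ≡ᵇ s ∸ 1))

-- `mkGraph` symmetrises `e`, so it is enough to check each edge in the orientation in which `e`
-- lists it.
mkGraph-⊆ : ∀ {s n} e (H : Graph n) (f : Fin s → Fin n) → Injective _≡_ _≡_ f →
  (∀ i j → e (toℕ i) (toℕ j) ≡ true → adj H (f i) (f j) ≡ true) → mkGraph s e ⊆G H
mkGraph-⊆ e H f f-inj edges = f , f-inj , λ i j eq → case ∨-split {e (toℕ i) (toℕ j)} (proj₁ (∧-split eq)) of λ
  { (inj₁ eᵢⱼ) → edges i j eᵢⱼ
  ; (inj₂ eⱼᵢ) → adj-swap H (edges j i eⱼᵢ) }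

mkGraph-adj : ∀ {s} (e : ℕ → ℕ → Bool) (i j : Fin s) → i ≢ j → e (toℕ i) (toℕ j) ≡ true → adj (mkGraph s e) i j ≡ true
mkGraph-adj e i j i≢j eq rewrite eq | ≢-≟ i≢j = refl

starE-sound : ∀ t a b → starE t a b ≡ true → a ≡ 0 × 1 ≤ b × b ≤ t
starE-sound t a b eq =
  let (a≡0 , rest) = ∧-split {a ≡ᵇ 0} eq
      (1≤b , b≤t) = ∧-split {1 ≤ᵇ b} rest
  in ≡ᵇ-sound a 0 a≡0 , ≤ᵇ-sound 1 b 1≤b , ≤ᵇ-sound b t b≤t

starE-complete : ∀ {t b} → 1 ≤ b → b ≤ t → starE t 0 b ≡ true
starE-complete 1≤b b≤t rewrite ≤ᵇ-complete 1≤b | ≤ᵇ-complete b≤t = refl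

edge-sound : ∀ a b c d → (a ≡ᵇ c) ∧ (b ≡ᵇ d) ≡ true → a ≡ c × b ≡ d
edge-sound a b c d eq = let (p , q) = ∧-split eq in ≡ᵇ-sound a c p , ≡ᵇ-sound b d q

at-centre : ∀ {s} {A : Set} {f : Fin s → A} {v} (i : Fin (suc s)) → toℕ i ≡ 0 → (v V.∷ f) i ≡ v
at-centre zero _ = refl

-- An injective image of the vertices v₀, …, v_{s−1} of T^j_s, s = k + 5, sending v₀ to v and the last four to a, b, x, y.
record Placement {n} (H : Graph n) (k : ℕ) (v a b x y : Fin n) : Set where
  field
    place     : Fin (suc (k + 4)) → Fin n
    injective : Injective _≡_ _≡_ place
    at-v      : ∀ i → toℕ i ≡ 0 → place i ≡ v
    at-leaf   : ∀ i → 1 ≤ toℕ i → toℕ i ≤ k + 2 → adj H v (place i) ≡ true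
    at-a      : ∀ i → toℕ i ≡ k + 1 → place i ≡ a
    at-b      : ∀ i → toℕ i ≡ k + 2 → place i ≡ b
    at-x      : ∀ i → toℕ i ≡ k + 3 → place i ≡ x
    at-y      : ∀ i → toℕ i ≡ k + 4 → place i ≡ y

-- The centre needs `k + 2` neighbours other than the end vertices; `a` and `b` are two of them and
-- `select` finds the other `k`. Since `x` and `y` may themselves be neighbours of `v`, the count is
-- taken after deleting them.
placement : ∀ {n} (H : Graph n) k {v a b x y} →
  adj H v a ≡ true → adj H v b ≡ true → a ≢ b → x ≢ y →
  Avoids (v ∷ a ∷ b ∷ []) x → Avoids (v ∷ a ∷ b ∷ []) y →
  2 + k ≤ count (adj H v ∖ x ∖ y) → Placement H k v a b x y
placement {n} H k {v} {a} {b} {x} {y} va vb a≢b x≢y (x≢v , x≢a , x≢b , _) (y≢v , y≢a , y≢b , _) room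
  with select k (adj H v ∖ x ∖ y) (a ∷ b ∷ []) room
... | g , g-inj , good = record
  { place     = v V.∷ (g V.++ t)
  ; injective = cons-injective (append-all (_≢ v) (λ i → ≢v (vg i)) t≢v) (append-injective g-inj t-inj g≢t)
  ; at-v      = at-centre
  ; at-leaf   = leaf
  ; at-a      = λ i → at i 0F
  ; at-b      = λ i → at i 1F
  ; at-x      = λ i → at i 2F
  ; at-y      = λ i → at i 3F
  }
  where
  t : Fin 4 → Fin n
  t = a V.∷ b V.∷ x V.∷ y V.∷ V.[]

  ≢v : ∀ {u} → adj H v u ≡ true → u ≢ v
  ≢v vu = adj-≢ H vu ∘ sym

  vg : ∀ i → adj H v (g i) ≡ true
  vg i = proj₁ (∖-elim (adj H v) (proj₁ (∖-elim (adj H v ∖ x) (proj₁ (good i)))))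

  t≢v : ∀ c → t c ≢ v
  t≢v 0F = ≢v va
  t≢v 1F = ≢v vb
  t≢v 2F = x≢v
  t≢v 3F = y≢v

  t-inj : Injective _≡_ _≡_ t
  t-inj = cons-injective {f = b V.∷ x V.∷ y V.∷ V.[]} (λ { 0F → a≢b ∘ sym ; 1F → x≢a ; 2F → y≢a })
    (cons-injective {f = x V.∷ y V.∷ V.[]} (λ { 0F → x≢b ; 1F → y≢b })
    (cons-injective {f = y V.∷ V.[]} (λ { 0F → x≢y ∘ sym })
    (cons-injective {f = V.[]} (λ ()) λ {})))

  g≢t : ∀ i c → g i ≢ t c
  g≢t i 0F = proj₁ (proj₂ (good i))
  g≢t i 1F = proj₁ (proj₂ (proj₂ (good i)))
  g≢t i 2F = proj₂ (∖-elim (adj H v) (proj₁ (∖-elim (adj H v ∖ x) (proj₁ (good i)))))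
  g≢t i 3F = proj₂ (∖-elim (adj H v ∖ x) (proj₁ (good i)))

  at : ∀ i c → toℕ i ≡ k + suc (toℕ c) → (v V.∷ (g V.++ t)) i ≡ t c
  at zero    c eq = case trans eq (+-suc k (toℕ c)) of λ ()
  at (suc i) c eq = append-at g t i c (ℕ-suc-injective (trans eq (+-suc k (toℕ c))))

  leaf : ∀ i → 1 ≤ toℕ i → toℕ i ≤ k + 2 → adj H v ((v V.∷ (g V.++ t)) i) ≡ true
  leaf (suc i) _ i<k+2 with splitAt k {4} i in eq
  ... | inj₁ i′ = vg i′
  ... | inj₂ 0F = va
  ... | inj₂ 1F = vb
  -- These are the positions of `x` and `y`, which lie beyond the last spoke.
  ... | inj₂ (suc (suc c)) = contradiction i<k+2 (<⇒≱ (s≤s (begin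
    k + 2                     ≤⟨ +-monoʳ-≤ k (s≤s (s≤s z≤n)) ⟩
    k + toℕ {4} (suc (suc c)) ≡⟨ toℕ-↑ʳ k (suc (suc c)) ⟨
    toℕ (k ↑ʳ suc (suc c))    ≡⟨ cong toℕ (splitAt⁻¹-↑ʳ {i = i} eq) ⟩
    toℕ i                     ∎)))
    where open ≤-Reasoning

T¹-⊆ : ∀ {n} (H : Graph n) k {v a b x y} → Placement H k v a b x y →
  adj H a x ≡ true → adj H b y ≡ true → T¹ (suc (k + 4)) ⊆G H
T¹-⊆ H k {v} {a} {b} {x} {y} pl ax by = mkGraph-⊆ (E¹ (suc (k + 4))) H place injective edges
  where
  open Placement pl
  edges : ∀ i j → E¹ (suc (k + 4)) (toℕ i) (toℕ j) ≡ true → adj H (place i) (place j) ≡ true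
  edges i j eq with ∨-split {starE ((suc (k + 4)) ∸ 3) (toℕ i) (toℕ j)} eq
  -- Addition recurses on `k`, so `k + 4 ∸ 2` is stuck; `+-∸-assoc` turns it into `k + 2`, and
  -- similarly below.
  ... | inj₁ star = let (i≡0 , 1≤j , j≤) = starE-sound _ (toℕ i) (toℕ j) star in
    subst (λ u → adj H u (place j) ≡ true) (sym (at-v i i≡0))
      (at-leaf j 1≤j (≤-trans j≤ (≤-reflexive (+-∸-assoc k {4} {2} (s≤s (s≤s z≤n))))))
  ... | inj₂ rest with ∨-split rest
  ...   | inj₁ e = let (i≡ , j≡) = edge-sound (toℕ i) (toℕ j) _ _ e in
    trans (cong₂ (adj H) (at-a i (trans i≡ (+-∸-assoc k {4} {3} (s≤s (s≤s (s≤s z≤n))))))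
                         (at-x j (trans j≡ (+-∸-assoc k {4} {1} (s≤s z≤n))))) ax
  ...   | inj₂ e = let (i≡ , j≡) = edge-sound (toℕ i) (toℕ j) _ _ e in
    trans (cong₂ (adj H) (at-b i (trans i≡ (+-∸-assoc k {4} {2} (s≤s (s≤s z≤n)))))
                         (at-y j j≡)) by

T²-⊆ : ∀ {n} (H : Graph n) k {v a b x y} → Placement H k v a b x y →
  adj H b x ≡ true → adj H b y ≡ true → T² (suc (k + 4)) ⊆G H
T²-⊆ H k {v} {a} {b} {x} {y} pl bx by = mkGraph-⊆ (E² (suc (k + 4))) H place injective edges
  where
  open Placement pl
  edges : ∀ i j → E² (suc (k + 4)) (toℕ i) (toℕ j) ≡ true → adj H (place i) (place j) ≡ true
  edges i j eq with ∨-split {starE ((suc (k + 4)) ∸ 3) (toℕ i) (toℕ j)} eq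
  ... | inj₁ star = let (i≡0 , 1≤j , j≤) = starE-sound _ (toℕ i) (toℕ j) star in
    subst (λ u → adj H u (place j) ≡ true) (sym (at-v i i≡0))
      (at-leaf j 1≤j (≤-trans j≤ (≤-reflexive (+-∸-assoc k {4} {2} (s≤s (s≤s z≤n))))))
  ... | inj₂ rest with ∨-split rest
  ...   | inj₁ e = let (i≡ , j≡) = edge-sound (toℕ i) (toℕ j) _ _ e in
    trans (cong₂ (adj H) (at-b i (trans i≡ (+-∸-assoc k {4} {2} (s≤s (s≤s z≤n)))))
                         (at-x j (trans j≡ (+-∸-assoc k {4} {1} (s≤s z≤n))))) bx
  ...   | inj₂ e = let (i≡ , j≡) = edge-sound (toℕ i) (toℕ j) _ _ e in
    trans (cong₂ (adj H) (at-b i (trans i≡ (+-∸-assoc k {4} {2} (s≤s (s≤s z≤n)))))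
                         (at-y j j≡)) by

-- The `d + 1` spokes are `a`, which is extended by `x`, and `d` neighbours of `v` other than `a`
-- and `x`. Since `x` may be adjacent to `v`, it is deleted before counting.
T′-⊆ : ∀ {n} (G : Graph n) d {v a x} →
  adj G v a ≡ true → adj G a x ≡ true → x ≢ v → suc d ≤ count (adj G v ∖ x) →
  T′ (suc (suc (d + 1))) ⊆G G
T′-⊆ {n} G d {v} {a} {x} va ax x≢v room with select d (adj G v ∖ x) (a ∷ []) room
... | g , g-inj , good = mkGraph-⊆ (E′ (suc (suc (d + 1)))) G f f-inj edges
  where
  f : Fin (suc (suc (d + 1))) → Fin n
  f = v V.∷ a V.∷ (g V.++ λ (_ : Fin 1) → x)

  vg : ∀ i → adj G v (g i) ≡ true × g i ≢ x
  vg i = ∖-elim (adj G v) (proj₁ (good i))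

  ≢v : ∀ {u} → adj G v u ≡ true → u ≢ v
  ≢v vu = adj-≢ G vu ∘ sym

  f-inj : Injective _≡_ _≡_ f
  f-inj = cons-injective
    (λ { zero → ≢v va ; (suc i) → append-all {g = λ (_ : Fin 1) → x} (_≢ v) (≢v ∘ proj₁ ∘ vg) (λ _ → x≢v) i })
    (cons-injective
      (append-all {g = λ (_ : Fin 1) → x} (_≢ a) (λ i → proj₁ (proj₂ (good i))) (λ _ → adj-≢ G ax ∘ sym))
      (append-injective {g = λ (_ : Fin 1) → x} g-inj (λ { {0F} {0F} _ → refl }) λ i _ → proj₂ (vg i)))

  leaf : ∀ j → 1 ≤ toℕ j → toℕ j ≤ d + 1 → adj G v (f j) ≡ true
  leaf (suc zero)    _ _ = va
  leaf (suc (suc i)) _ i<d+1 with splitAt d {1} i in eq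
  ... | inj₁ i′ = proj₁ (vg i′)
  ... | inj₂ 0F = contradiction i<d+1 (<⇒≱ (s≤s (≤-reflexive (begin
    d + 1          ≡⟨ +-comm d 1 ⟩
    suc d          ≡⟨ cong suc (+-identityʳ d) ⟨
    suc (d + 0)    ≡⟨ cong suc (toℕ-↑ʳ d 0F) ⟨
    suc (toℕ (d ↑ʳ 0F)) ≡⟨ cong (suc ∘ toℕ) (splitAt⁻¹-↑ʳ {i = i} eq) ⟩
    suc (toℕ i)    ∎))))
    where open ≡-Reasoning

  at-a : ∀ i → toℕ i ≡ 1 → f i ≡ a
  at-a (suc zero) _ = refl

  at-x : ∀ i → toℕ i ≡ suc (d + 1) → f i ≡ x
  at-x (suc zero)    eq = case trans eq (cong suc (+-comm d 1)) of λ ()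
  at-x (suc (suc i)) eq = append-at g (λ (_ : Fin 1) → x) i 0F
    (ℕ-suc-injective (trans (ℕ-suc-injective eq) (trans (+-comm d 1) (cong suc (sym (+-identityʳ d))))))

  edges : ∀ i j → E′ (suc (suc (d + 1))) (toℕ i) (toℕ j) ≡ true → adj G (f i) (f j) ≡ true
  edges i j eq with ∨-split {starE ((suc (suc (d + 1))) ∸ 2) (toℕ i) (toℕ j)} eq
  ... | inj₁ star = let (i≡0 , 1≤j , j≤) = starE-sound _ (toℕ i) (toℕ j) star in
    subst (λ u → adj G u (f j) ≡ true) (sym (at-centre i i≡0)) (leaf j 1≤j j≤)
  ... | inj₂ e = let (i≡ , j≡) = edge-sound (toℕ i) (toℕ j) _ _ e in
    trans (cong₂ (adj G) (at-a i i≡) (at-x j j≡)) ax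

-- One configuration serves both trees: T¹ takes the end edges `ax` and `by`, T² takes `bx` and
-- `by`. The inequalities not listed follow from the adjacencies.
T-⊆ : ∀ {n j} (H : Graph n) k {v a b x y} → j ≡ 1 ⊎ j ≡ 2 →
  adj H v a ≡ true → adj H v b ≡ true → a ≢ b → x ≢ y → x ≢ v → y ≢ v → y ≢ a →
  adj H a x ≡ true → adj H b x ≡ true → adj H b y ≡ true →
  2 + k ≤ count (adj H v ∖ x ∖ y) → T j (suc (k + 4)) ⊆G H
T-⊆ H k {v} {a} {b} {x} {y} j∈ va vb a≢b x≢y x≢v y≢v y≢a ax bx by room = case j∈ of λ
  { (inj₁ refl) → T¹-⊆ H k placed ax by
  ; (inj₂ refl) → T²-⊆ H k placed bx by }
  where
  placed : Placement H k v a b x y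
  placed = placement H k va vb a≢b x≢y
    (x≢v , adj-≢ H ax ∘ sym , adj-≢ H bx ∘ sym , tt) (y≢v , y≢a , adj-≢ H by ∘ sym , tt) room

-- Trees in the complement of a graph with a separate component.

separated : ∀ {n} (P : Pred n) {x y} → P x ≡ true → P y ≡ false → x ≢ y
separated P Px Py refl = true≢false Px Py

co-false-intro : ∀ {n} (G : Graph n) {x y} → adj G x y ≡ true → adj (complement G) x y ≡ false
co-false-intro G eq rewrite eq = refl

not-false : ∀ {b} → not b ≡ false → b ≡ true
not-false {true} _ = refl

not-intro : ∀ {b} → b ≡ false → not b ≡ true
not-intro refl = refl

not-elim : ∀ {b} → not b ≡ true → b ≡ false
not-elim {false} _ = refl

∖-false : ∀ {n} (P : Pred n) {x u} → P u ≡ false → (P ∖ x) u ≡ false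
∖-false P eq rewrite eq = refl

count-∖∖ : ∀ {n} (P : Pred n) x y → count P ≤ 2 + count (P ∖ x ∖ y)
count-∖∖ P x y = ≤-trans (count-∖ P x) (s≤s (count-∖ (P ∖ x) y))

count-∖∖-∉ : ∀ {n} (P : Pred n) {x y} → P x ≡ false → P y ≡ false → count P ≤ count (P ∖ x ∖ y)
count-∖∖-∉ P {x} Px Py = ≤-trans (count-∖-∉ P Px) (count-∖-∉ (P ∖ x) (∖-false P Py))

count-true : ∀ n → count {n} (λ _ → true) ≡ n
count-true n = trans (sum-const n 1) (*-identityʳ n)

-- Take `a` and `b` across the cut and `x` and `y` on the side of `w`; the cut then supplies all
-- edges but the remaining spokes. Deleting `x` and `y` must leave `k + 2` neighbours of `w`, and
-- there are two ways to ensure this.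
join-side-⊆ : ∀ {N j} (G : Graph N) k → j ≡ 1 ⊎ j ≡ 2 → let H = complement G in (C : Pred N) →
  (∀ a x → C a ≡ true → C x ≡ false → adj H a x ≡ true) →
  3 ≤ count C → 3 ≤ count (not ∘ C) → k + 6 ≤ N →
  ∀ w → C w ≡ true → 2 + k ≤ deg H w → T j (suc (k + 4)) ⊆G H
join-side-⊆ {N} {j} G k j∈ C cross 3≤C 3≤C̄ k+6≤N w Cw 2+k≤deg =
  let (a , b , C̄a , C̄b , a≢b , _) = pick₂ (not ∘ C) [] (≤-trans (n≤1+n _) 3≤C̄)
      (x , y , Cx , Cy , x≢y , x≢w , y≢w , room) = pendants
      Ca = not-elim C̄a
      Cb = not-elim C̄b
  in T-⊆ H k j∈ (cross w a Cw Ca) (cross w b Cw Cb) a≢b x≢y x≢w y≢w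
       (separated C Cy Ca)
       (adj-swap H (cross x a Cx Ca)) (adj-swap H (cross x b Cx Cb)) (adj-swap H (cross y b Cy Cb)) room
  where
  H = complement G
  pendants : ∃ λ x → ∃ λ y → C x ≡ true × C y ≡ true × x ≢ y × x ≢ w × y ≢ w × 2 + k ≤ count (adj H w ∖ x ∖ y)
  pendants with <-≤-connex (deg H w) (k + 4)
  -- With at least `k + 4` neighbours, any two end vertices can be spared.
  ... | inj₂ k+4≤deg =
    let (x , y , Cx , Cy , x≢y , (x≢w , _) , (y≢w , _)) = pick₂ C (w ∷ []) 3≤C
    in x , y , Cx , Cy , x≢y , x≢w , y≢w , +-cancelˡ-≤ 2 _ _
         (≤-trans (≤-reflexive (+-comm 4 k)) (≤-trans k+4≤deg (count-∖∖ (adj H w) x y)))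
  -- Otherwise `w` has two neighbours in `G`. They lie in `C`, as no edge of `G` crosses the cut,
  -- and deleting them costs nothing.
  ... | inj₁ deg<k+4 =
    let (x , y , wx , wy , x≢y , _) = pick₂ (adj G w) [] (room (deg-complement G w) deg<k+4 k+6≤N)
    in x , y , inside wx , inside wy , x≢y , adj-≢ G wx ∘ sym , adj-≢ G wy ∘ sym
     , ≤-trans 2+k≤deg (count-∖∖-∉ (adj H w) (co-false-intro G wx) (co-false-intro G wy))
    where
    inside : ∀ {u} → adj G w u ≡ true → C u ≡ true
    inside {u} wu with bool-cases (C u)
    ... | inj₁ Cu = Cu
    ... | inj₂ C̄u = ⊥-elim (true≢false wu (co-elim G (cross w u Cw C̄u)))
    room : ∀ {g h} → suc (g + h) ≡ N → h < k + 4 → k + 6 ≤ N → 2 ≤ g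
    room {g} {h} refl h< N≥ = linear 0 (+-mono-≤ h< N≥) (solve (g ∷ h ∷ k ∷ []))

join-⊆ : ∀ {N j} (G : Graph N) k → j ≡ 1 ⊎ j ≡ 2 → let H = complement G in (C : Pred N) →
  (∀ a x → C a ≡ true → C x ≡ false → adj H a x ≡ true) →
  3 ≤ count C → 3 ≤ count (not ∘ C) → k + 6 ≤ N →
  ∀ w → 2 + k ≤ deg H w → T j (suc (k + 4)) ⊆G H
join-⊆ G k j∈ C cross 3≤C 3≤C̄ k+6≤N w 2+k≤deg with bool-cases (C w)
... | inj₁ Cw = join-side-⊆ G k j∈ C cross 3≤C 3≤C̄ k+6≤N w Cw 2+k≤deg
... | inj₂ C̄w = join-side-⊆ G k j∈ (not ∘ C)
  (λ a x C̄a C̄̄x → adj-swap (complement G) (cross x a (not-false C̄̄x) (not-elim C̄a)))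
  3≤C̄ (≤-trans 3≤C (count-mono C (not ∘ not ∘ C) λ u Cu → cong (not ∘ not) Cu))
  k+6≤N w (not-intro C̄w) 2+k≤deg

-- The leaves of a star component are joined in the complement to everything but the centre.
star-⊆ : ∀ {N j} (G : Graph N) k → j ≡ 1 ⊎ j ≡ 2 → 6 ≤ N → k + 6 ≤ N → ∀ v → 3 ≤ deg G v →
  (∀ a x → adj G v a ≡ true → x ≢ v → adj G a x ≡ false) → T j (suc (k + 4)) ⊆G complement G
star-⊆ {N} G k j∈ 6≤N k+6≤N v 3≤deg leaf =
  -- The tree is centred at a leaf `c` of the star. Its only possible neighbour in `G` is `v`, so
  -- its `H`-degree is at least `N - 2`, hence at least `k + 4`, and `x` and `y` can be spared.
  let (c , vc , _) = pick (adj G v) [] (≤-trans (s≤s z≤n) 3≤deg)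
      (a , b , va , vb , a≢b , (a≢c , _) , (b≢c , _)) = pick₂ (adj G v) (c ∷ []) 3≤deg
      (x , y , _ , _ , x≢y , (x≢v , x≢a , x≢b , x≢c , _) , (y≢v , y≢a , y≢b , y≢c , _)) =
        pick₂ (λ _ → true) (v ∷ a ∷ b ∷ c ∷ []) (≤-trans 6≤N (≤-reflexive (sym (count-true N))))
  in T-⊆ H k j∈ (join vc (v≢ va) a≢c) (join vc (v≢ vb) b≢c) a≢b x≢y x≢c y≢c y≢a
       (join va x≢v x≢a) (join vb x≢v x≢b) (join vb y≢v y≢b)
       (+-cancelˡ-≤ 2 _ _ (≤-trans (degree (deg-complement G c) (leaf-degree c vc) k+6≤N) (count-∖∖ (adj H c) x y)))
  where
  H = complement G
  v≢ : ∀ {u} → adj G v u ≡ true → u ≢ v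
  v≢ vu = adj-≢ G vu ∘ sym
  join : ∀ {a x} → adj G v a ≡ true → x ≢ v → x ≢ a → adj H a x ≡ true
  join va x≢v x≢a = co-intro G (x≢a ∘ sym) (leaf _ _ va x≢v)
  leaf-degree : ∀ c → adj G v c ≡ true → deg G c ≤ 1
  leaf-degree c vc = ≤-trans (count-mono (adj G c) (λ u → ⌊ u ≟ v ⌋) only-v) (≤-reflexive (count-≟ v))
    where
    only-v : ∀ u → adj G c u ≡ true → ⌊ u ≟ v ⌋ ≡ true
    only-v u cu with u ≟ v
    ... | yes _ = refl
    ... | no u≢v = ⊥-elim (true≢false cu (leaf c u vc u≢v))
  degree : ∀ {g h} → suc (g + h) ≡ N → g ≤ 1 → k + 6 ≤ N → 2 + (2 + k) ≤ h
  degree {g} {h} refl g≤1 N≥ = linear 0 (+-mono-≤ g≤1 N≥) (solve (g ∷ h ∷ k ∷ []))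

-- Graphs with all degrees at most `d`: a tree centred at `v`.

module LowDegree {N} (G : Graph N) (d k : ℕ) (4≤d : 4 ≤ d) (d≤k+1 : d ≤ k + 1) (N≥ : d + k + 2 ≤ N)
  (low : ∀ u → deg G u ≤ d) (v : Fin N) where

  private H = complement G

  codegree : ∀ u → k + 1 ≤ deg H u
  codegree u = bound (deg-complement G u) (low u) N≥
    where
    bound : ∀ {g h} → suc (g + h) ≡ N → g ≤ d → d + k + 2 ≤ N → k + 1 ≤ h
    bound {g} {h} refl g≤d N≥ = linear 0 (+-mono-≤ g≤d N≥) (solve (g ∷ h ∷ k ∷ d ∷ []))

  4≤codegree : ∀ u → 4 ≤ deg H u
  4≤codegree u = ≤-trans 4≤d (≤-trans d≤k+1 (codegree u))

  common : Fin N → Pred N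
  common b u = adj H v u ∧ adj H b u

  -- Every vertex of N_H(v) is either a common `H`-neighbour of `v` and `b` or a `G`-neighbour of
  -- `b`. The vertex `v` is also a `G`-neighbour of `b`, which gives the extra 1.
  common-count : ∀ {b} → adj G v b ≡ true → deg H v + 1 ≤ count (common b) + d
  common-count {b} vb = begin
    deg H v + 1                                   ≡⟨ cong (deg H v +_) (count-≟ v) ⟨
    deg H v + count (λ u → ⌊ u ≟ v ⌋)             ≡⟨ ∑-distrib-+ (⟦_⟧ ∘ adj H v) (λ u → ⟦ ⌊ u ≟ v ⌋ ⟧) ⟨
    sum (λ u → ⟦ adj H v u ⟧ + ⟦ ⌊ u ≟ v ⌋ ⟧)     ≤⟨ sum-mono-+ pointwise ⟩
    count (common b) + deg G b                    ≤⟨ +-monoʳ-≤ _ (low b) ⟩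
    count (common b) + d                          ∎
    where
    open ≤-Reasoning
    pointwise : ∀ u → ⟦ adj H v u ⟧ + ⟦ ⌊ u ≟ v ⌋ ⟧ ≤ ⟦ common b u ⟧ + ⟦ adj G b u ⟧
    pointwise u with u ≟ v
    ... | yes refl rewrite adj-irr H u | adj-swap G vb = ≤-refl
    ... | no u≢v with bool-cases (adj H v u) | bool-cases (adj G b u)
    ...   | inj₂ vu | _ rewrite vu = z≤n
    ...   | inj₁ vu | inj₁ bu rewrite vu | bu = ≤-refl
    -- Here `u` differs from `b`, because `b` is not an `H`-neighbour of `v`.
    ...   | inj₁ vu | inj₂ bu rewrite vu
      | co-intro G {b} {u} (λ { refl → true≢false vu (co-false-intro G vb) }) bu | bu = ≤-refl

  2≤common : ∀ {b} → 2 + k ≤ deg H v → adj G v b ≡ true → 2 ≤ count (common b)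
  2≤common {b} room vb = bound (common-count vb) room d≤k+1
    where
    bound : ∀ {h c} → h + 1 ≤ c + d → 2 + k ≤ h → d ≤ k + 1 → 2 ≤ c
    bound {h} {c} p q r = linear 0 (+-mono-≤ p (+-mono-≤ q r)) (solve (h ∷ c ∷ k ∷ d ∷ []))

  -- N_H(v) has exactly the required size, so the two end vertices must be G-neighbours of v.
  module Tight (tight : deg H v ≡ 2 + k) where
    room : 2 + k ≤ deg H v
    room = ≤-reflexive (sym tight)

    d≤1+deg : d ≤ 1 + deg G v
    d≤1+deg = bound (deg-complement G v) (≤-reflexive tight) N≥
      where
      bound : ∀ {g h} → suc (g + h) ≡ N → h ≤ 2 + k → d + k + 2 ≤ N → d ≤ 1 + g
      bound {g} {h} refl p q = linear 0 (+-mono-≤ p q) (solve (h ∷ g ∷ k ∷ d ∷ []))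

    room-outside : ∀ {x y} → adj G v x ≡ true → adj G v y ≡ true → 2 + k ≤ count (adj H v ∖ x ∖ y)
    room-outside vx vy = ≤-trans room (count-∖∖-∉ (adj H v) (co-false-intro G vx) (co-false-intro G vy))

    apart : ∀ {a x} → adj H v a ≡ true → adj G v x ≡ true → x ≢ a
    apart va vx refl = true≢false vx (co-elim G va)

    2≤deg : 2 ≤ deg G v
    2≤deg = ≤-trans (s≤s (s≤s z≤n)) (s≤s⁻¹ (≤-trans 4≤d d≤1+deg))

    -- Two `G`-neighbours `x` and `y` of `v` each share at least two `H`-neighbours with `v`, so
    -- distinct `a` and `b` can be chosen for them.
    T¹-tight : T¹ (suc (k + 4)) ⊆G H
    T¹-tight =
      let (x , y , vx , vy , x≢y , _) = pick₂ (adj G v) [] 2≤deg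
          (a , ca , _) = pick (common x) [] (≤-trans (s≤s z≤n) (2≤common room vx))
          (b , cb , b≢a , _) = pick (common y) (a ∷ []) (2≤common room vy)
          (va , xa) = ∧-split ca
          (vb , yb) = ∧-split cb
      in T¹-⊆ H k
           (placement H k va vb (b≢a ∘ sym) x≢y
             (adj-≢ G vx ∘ sym , apart va vx , apart vb vx , tt) (adj-≢ G vy ∘ sym , apart va vy , apart vb vy , tt)
             (room-outside vx vy))
           (adj-swap H xa) (adj-swap H yb)

    outer : Fin N → Pred N
    outer a b = adj G v b ∧ adj H b a

    -- Double counting the complement edges between N_G(v) and N_H(v).
    hub : ∃ λ a → adj H v a ≡ true × 2 ≤ count (outer a)
    hub with any? (λ a → (adj H v a Bool.≟ true) ×-dec (2 ≤? count (outer a)))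
    ... | yes found = found
    ... | no none = ⊥-elim (absurd (m∸n+n≡m d≤k+3) 4≤d d≤1+deg (≤-trans lower (≤-trans (≤-reflexive (∑-comm edge)) upper)))
      where
      -- By `common-count`, each `G`-neighbour of `v` has at least this many `H`-neighbours in
      -- N_H(v). If no hub exists, each of the `2 + k` vertices of N_H(v) receives at most one such
      -- edge.
      c = k + 3 ∸ d

      d≤k+3 : d ≤ k + 3
      d≤k+3 = ≤-trans d≤k+1 (+-monoʳ-≤ k (s≤s z≤n))

      edge : Fin N → Fin N → ℕ
      edge b a = ⟦ adj G v b ∧ common b a ⟧

      lower : deg G v * c ≤ sum (λ b → sum (edge b))
      lower = ≤-trans (≤-reflexive (*-distribʳ-sum c (⟦_⟧ ∘ adj G v))) (sum-mono per-b)
        where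
        per-b : ∀ b → ⟦ adj G v b ⟧ * c ≤ sum (edge b)
        per-b b with adj G v b in vb
        ... | false = z≤n
        ... | true  = ≤-trans (≤-reflexive (+-identityʳ c))
          (m≤n+o⇒m∸n≤o (k + 3) d (subst (k + 3 ≤_) (+-comm _ d)
            (≤-trans (≤-reflexive (trans (+-comm k 3) (trans (cong suc (sym tight)) (+-comm 1 _)))) (common-count vb))))

      upper : sum (λ a → sum (λ b → edge b a)) ≤ 2 + k
      upper = ≤-trans (sum-mono per-a) (≤-reflexive tight)
        where
        per-a : ∀ a → sum (λ b → edge b a) ≤ ⟦ adj H v a ⟧
        per-a a with bool-cases (adj H v a)
        ... | inj₂ va = ≤-trans (sum-mono zeros) (≤-trans (≤-reflexive (trans (sum-const N 0) (*-zeroʳ N))) z≤n)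
          where
          zeros : ∀ b → edge b a ≤ 0
          zeros b rewrite va with adj G v b
          ... | true  = z≤n
          ... | false = z≤n
        ... | inj₁ va = ≤-trans (sum-mono λ b → ⟦⟧-mono (drop b))
          (≤-trans (s≤s⁻¹ (≰⇒> λ 2≤ → none (a , va , 2≤))) (≤-reflexive (sym (cong ⟦_⟧ va))))
          where
          drop : ∀ b → adj G v b ∧ common b a ≡ true → outer a b ≡ true
          drop b eq with adj G v b
          ... | true = proj₂ (∧-split {adj H v a} eq)

      -- Since `2 + k` is `c + d - 1` and `g` is at least `d - 1`, the bound gives
      -- `(d - 2) * c ≤ d - 1`; with `c` at least 2 this forces `d ≤ 3`.
      absurd : ∀ {g} → c + d ≡ k + 3 → 4 ≤ d → d ≤ 1 + g → g * c ≤ 2 + k → ⊥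
      absurd {g} c+d≡ 4≤d d≤1+g gc≤ =
        nonlinear c (+-cancelʳ-≤ d 2 c (≤-trans (+-monoʳ-≤ 2 d≤k+1) (≤-reflexive (trans 2+k+1≡k+3 (sym c+d≡)))))
          c+d≡ 4≤d d≤1+g gc≤
        where
        2+k+1≡k+3 : 2 + (k + 1) ≡ k + 3
        2+k+1≡k+3 = solve (k ∷ [])
        nonlinear : ∀ c → 2 ≤ c → c + d ≡ k + 3 → 4 ≤ d → d ≤ 1 + g → g * c ≤ 2 + k → ⊥
        nonlinear c 2≤c c+d≡ 4≤d d≤1+g gc≤ with m≤n⇒∃[o]m+o≡n 2≤c | m≤n⇒∃[o]m+o≡n 4≤d
        ... | c′ , refl | d′ , refl with m≤n⇒∃[o]m+o≡n (s≤s⁻¹ d≤1+g)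
        ...   | g′ , refl = case linear {a = 1} {b = 0} (d′ + 2 * g′ + 2 * c′ + d′ * c′ + g′ * c′)
          (+-mono-≤ gc≤ (≤-reflexive (sym c+d≡))) (solve (c′ ∷ d′ ∷ g′ ∷ k ∷ [])) of λ ()

    T²-tight : T² (suc (k + 4)) ⊆G H
    T²-tight =
      -- The hub carries both end vertices, so it takes the place of `b` in the placement.
      let (a , va , 2≤) = hub
          (x , y , ox , oy , x≢y , _) = pick₂ (outer a) [] 2≤
          (vx , xa) = ∧-split ox
          (vy , ya) = ∧-split oy
          (b , vb , b≢a , _) = pick (adj H v) (a ∷ []) (≤-trans (s≤s (s≤s z≤n)) room)
      in T²-⊆ H k
           (placement H k vb va b≢a x≢y
             (adj-≢ G vx ∘ sym , apart vb vx , apart va vx , tt) (adj-≢ G vy ∘ sym , apart vb vy , apart va vy , tt)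
             (room-outside vx vy))
           (adj-swap H xa) (adj-swap H ya)

  module Loose (loose : 3 + k ≤ deg H v) where
    -- A `G`-neighbour `x` of `v` can be deleted at no cost. If there is none, `v` has `H`-degree
    -- `N - 1`, which is large enough to lose one neighbour. The `k + 3` neighbours left allow the
    -- second end vertex to be arbitrary, even a neighbour of `v`.
    exit : ∃ λ a → ∃ λ x → adj H v a ≡ true × adj H a x ≡ true × x ≢ v × 3 + k ≤ count (adj H v ∖ x)
    exit with any? (λ b → adj G v b Bool.≟ true)
    ... | yes (x , vx) =
      let (a , ca , _) = pick (common x) [] (≤-trans (s≤s z≤n) (2≤common (≤-trans (n≤1+n _) loose) vx))
          (va , xa) = ∧-split ca
      in a , x , va , adj-swap H xa , adj-≢ G vx ∘ sym
       , ≤-trans loose (count-∖-∉ (adj H v) (co-false-intro G vx))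
    ... | no isolated =
      let (a , va , _) = pick (adj H v) [] (≤-trans (s≤s z≤n) loose)
          (x , ax , x≢v , _) = pick (adj H a) (v ∷ []) (≤-trans (s≤s (s≤s z≤n)) (4≤codegree a))
      in a , x , va , ax , x≢v , s≤s⁻¹ (≤-trans (bound (deg-complement G v) no-degree 4≤d N≥) (count-∖ (adj H v) x))
      where
      no-degree : deg G v ≤ 0
      no-degree = ≮⇒≥ λ 0< → isolated (count-witness (adj G v) 0<)
      bound : ∀ {g h} → suc (g + h) ≡ N → g ≤ 0 → 4 ≤ d → d + k + 2 ≤ N → 4 + k ≤ h
      bound {g} {h} refl p q r = linear 1 (+-mono-≤ p (+-mono-≤ q r)) (solve (h ∷ g ∷ k ∷ d ∷ []))

    T¹-loose : T¹ (suc (k + 4)) ⊆G H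
    T¹-loose =
      let (a , x , va , ax , x≢v , room) = exit
          (b , vb∖ , b≢a , _) = pick (adj H v ∖ x) (a ∷ []) (≤-trans (s≤s (s≤s z≤n)) room)
          (vb , b≢x) = ∖-elim (adj H v) vb∖
          (y , by , y≢v , y≢a , y≢x , _) = pick (adj H b) (v ∷ a ∷ x ∷ []) (4≤codegree b)
      in T¹-⊆ H k
           (placement H k va vb (b≢a ∘ sym) (y≢x ∘ sym)
             (x≢v , adj-≢ H ax ∘ sym , b≢x ∘ sym , tt) (y≢v , y≢a , adj-≢ H by ∘ sym , tt)
             (s≤s⁻¹ (≤-trans room (count-∖ (adj H v ∖ x) y))))
           ax by

    T²-loose : T² (suc (k + 4)) ⊆G H
    T²-loose =
      let (a , x , va , ax , x≢v , room) = exit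
          (y , ay , y≢v , y≢x , _) = pick (adj H a) (v ∷ x ∷ []) (≤-trans (s≤s (s≤s (s≤s z≤n))) (4≤codegree a))
          room′ = s≤s⁻¹ (≤-trans room (count-∖ (adj H v ∖ x) y))
          (b , vb∖∖ , b≢a , _) = pick (adj H v ∖ x ∖ y) (a ∷ []) (≤-trans (s≤s (s≤s z≤n)) room′)
          (vb∖ , b≢y) = ∖-elim (adj H v ∖ x) vb∖∖
          (vb , b≢x) = ∖-elim (adj H v) vb∖
      in T²-⊆ H k
           (placement H k vb va b≢a (y≢x ∘ sym)
             (x≢v , b≢x ∘ sym , adj-≢ H ax ∘ sym , tt) (y≢v , b≢y ∘ sym , adj-≢ H ay ∘ sym , tt)
             room′)
           ax ay

  low-degree-⊆ : ∀ {j} → j ≡ 1 ⊎ j ≡ 2 → 2 + k ≤ deg H v → T j (suc (k + 4)) ⊆G H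
  low-degree-⊆ j∈ room with m≤n⇒m<n∨m≡n room | j∈
  ... | inj₁ loose | inj₁ refl = Loose.T¹-loose loose
  ... | inj₁ loose | inj₂ refl = Loose.T²-loose loose
  ... | inj₂ tight | inj₁ refl = Tight.T¹-tight (sym tight)
  ... | inj₂ tight | inj₂ refl = Tight.T²-tight (sym tight)

-- Divisibility by class sizes, and the handshake lemma.

co-irr : ∀ {n} (G : Graph n) u → not (adj (complement G) u u) ≡ true
co-irr G u = not-intro (adj-irr (complement G) u)

partition-∣ : ∀ {n} (R : Fin n → Pred n) q → (∀ u → R u u ≡ true) →
  (∀ u w → R u w ≡ true → R w u ≡ true) →
  (∀ u w x → R u w ≡ true → R w x ≡ true → R u x ≡ true) →
  (∀ u → count (R u) ≡ q) → q ∣ n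
partition-∣ {n} R q R-refl R-sym R-trans size =
  subst (q ∣_) (count-true n) (closed-∣ n (λ _ → true) (λ _ _ _ _ → refl) (≤-reflexive (count-true n)))
  where
  -- Removing the class of some `x` in `P` takes away exactly `q` elements and leaves an `R`-closed
  -- set; `bound` is the fuel for the recursion.
  closed-∣ : ∀ bound (P : Pred n) → (∀ u w → P u ≡ true → R u w ≡ true → P w ≡ true) →
    count P ≤ bound → q ∣ count P
  closed-∣ bound P closed P≤bound with count P in eq
  ... | zero  = q ∣0
  closed-∣ (suc bound) P closed (s≤s c≤bound) | suc c =
    let (x , Px , _) = pick P [] (subst (0 <_) (sym eq) (s≤s z≤n)) in step x Px
    where
    step : ∀ x → P x ≡ true → q ∣ suc c
    step x Px = subst (q ∣_) (trans (sym split) eq)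
      (∣m∣n⇒∣m+n (subst (q ∣_) (sym (size x)) ∣-refl) (closed-∣ bound P′ closed′ smaller))
      where
      P′ : Pred n
      P′ u = P u ∧ not (R x u)

      closed′ : ∀ u w → P′ u ≡ true → R u w ≡ true → P′ w ≡ true
      closed′ u w P′u Ruw with ∧-split {P u} P′u | bool-cases (R x w)
      ... | Pu , ¬Rxu | inj₁ Rxw = ⊥-elim (not-true ¬Rxu (R-trans x w u Rxw (R-sym u w Ruw)))
      ... | Pu , ¬Rxu | inj₂ ¬Rxw = cong₂ _∧_ (closed u w Pu Ruw) (not-intro ¬Rxw)

      pointwise : ∀ u → ⟦ P u ⟧ ≡ ⟦ R x u ⟧ + ⟦ P′ u ⟧
      pointwise u with R x u in Rxu
      ... | false = cong ⟦_⟧ (sym (∧-identityʳ (P u)))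
      ... | true rewrite closed x u Px Rxu = refl

      split : count P ≡ count (R x) + count P′
      split = trans (sum-cong-≗ pointwise) (∑-distrib-+ (⟦_⟧ ∘ R x) (⟦_⟧ ∘ P′))

      smaller : count P′ ≤ bound
      smaller = ≤-trans (s≤s⁻¹ (begin
        1 + count P′           ≤⟨ +-monoˡ-≤ (count P′) (injection-count (R x) (λ (_ : Fin 1) → x) (λ { {0F} {0F} _ → refl }) (λ _ → R-refl x)) ⟩
        count (R x) + count P′ ≡⟨ trans (sym split) eq ⟩
        suc c                  ∎)) c≤bound
        where open ≤-Reasoning

-- The first row and the first column contribute equally, and deleting both leaves a symmetric
-- matrix with zero diagonal. Matrices make this induction simpler than graphs would.
handshake : ∀ {n} (F : Fin n → Fin n → ℕ) → (∀ i j → F i j ≡ F j i) → (∀ i → F i i ≡ 0) →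
  2 ∣ sum (λ i → sum (F i))
handshake {zero}  F F-sym F-irr = 2 ∣0
handshake {suc n} F F-sym F-irr = subst (2 ∣_) (sym total)
  (∣m∣n⇒∣m+n (m∣m*n row) (handshake (λ i j → F (suc i) (suc j)) (λ i j → F-sym (suc i) (suc j)) (F-irr ∘ suc)))
  where
  open ≡-Reasoning
  row rest : ℕ
  row  = sum (λ j → F zero (suc j))
  rest = sum (λ i → sum (λ j → F (suc i) (suc j)))
  total : sum (λ i → sum (F i)) ≡ 2 * row + rest
  total = begin
    F zero zero + row + sum (λ i → F (suc i) zero + sum (λ j → F (suc i) (suc j)))
      ≡⟨ cong₂ _+_ (cong (_+ row) (F-irr zero)) (∑-distrib-+ (λ i → F (suc i) zero) _) ⟩
    row + (sum (λ i → F (suc i) zero) + rest)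
      ≡⟨ cong (λ c → row + (c + rest)) (sum-cong-≗ λ i → F-sym (suc i) zero) ⟩
    row + (row + rest)
      ≡⟨ collect row rest ⟩
    2 * row + rest ∎
    where
    collect : ∀ a b → a + (a + b) ≡ 2 * a + b
    collect = solve-∀

regular-even : ∀ {n} (G : Graph n) d → (∀ u → deg G u ≡ d) → 2 ∣ n * d
regular-even {n} G d regular = subst (2 ∣_) (trans (sum-cong-≗ regular) (sum-const n d))
  (handshake (λ i j → ⟦ adj G i j ⟧) (λ i j → cong ⟦_⟧ (adj-sym G i j)) (λ i → cong ⟦_⟧ (adj-irr G i)))

-- The upper bound, by maximum degree.

module Upper {N j} (G : Graph N) (d k : ℕ) (j∈ : j ≡ 1 ⊎ j ≡ 2) (4≤d : 4 ≤ d) (d≤k+1 : d ≤ k + 1)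
  (N≥ : d + k + 2 ≤ N) where

  private H = complement G

  k+6≤N : k + 6 ≤ N
  k+6≤N = linear 0 (+-mono-≤ 4≤d N≥) (solve (k ∷ d ∷ N ∷ []))

  Goal : Set
  Goal = T j (suc (k + 4)) ⊆G H

  module _ (T′-free : ∀ v a x → adj G v a ≡ true → adj G a x ≡ true → x ≢ v → count (adj G v ∖ x) ≤ d) where

    -- Deleting any `x` leaves at least `d + 1` neighbours of `v`, so a neighbour of `v` with a
    -- second neighbour would yield T′_m. Hence `v` is the centre of a star component.
    large-degree : ∀ v → d + 2 ≤ deg G v → Goal
    large-degree v large = star-⊆ G k j∈ (≤-trans (m≤n+m 6 k) k+6≤N) k+6≤N v
      (≤-trans (s≤s (≤-trans (s≤s (s≤s z≤n)) 4≤d)) (≤-trans (≤-reflexive (+-comm 1 d)) (≤-trans (+-monoʳ-≤ d (s≤s z≤n)) large)))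
      leaf
      where
      leaf : ∀ a x → adj G v a ≡ true → x ≢ v → adj G a x ≡ false
      leaf a x va x≢v with bool-cases (adj G a x)
      ... | inj₂ ax = ax
      ... | inj₁ ax = contradiction (≤-trans large (≤-trans (count-∖ (adj G v) x) (s≤s (T′-free v a x va ax x≢v))))
        (<⇒≱ (≤-reflexive (+-comm 2 d)))

    -- The closed neighbourhood of `v` in `G`: `v` belongs to it because `H` has no loops.
    cluster : Fin N → Pred N
    cluster v u = not (adj H v u)

    -- An edge of `G` leaving the cluster would end at an `x` not adjacent to `v`, so all `d + 1`
    -- neighbours of `v` would survive its deletion, against `T′-free`.
    cluster-cross : ∀ v → deg G v ≡ d + 1 → ∀ a x → cluster v a ≡ true → cluster v x ≡ false → adj H a x ≡ true
    cluster-cross v deg≡ a x Ca C̄x with toSum (v ≟ a)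
    ... | inj₁ refl = not-false C̄x
    ... | inj₂ v≢a with bool-cases (adj G a x)
    ...   | inj₂ ¬ax = co-intro G (separated (cluster v) Ca C̄x) ¬ax
    ...   | inj₁ ax = contradiction (T′-free v a x (co-false G v≢a (not-elim Ca)) ax (adj-≢ H vx ∘ sym))
        (<⇒≱ (≤-trans (≤-reflexive (trans (+-comm 1 d) (sym deg≡))) (count-∖-∉ (adj G v) (co-elim G vx))))
      where vx = not-false C̄x

    cluster-size : ∀ v → deg G v ≡ d + 1 → count (cluster v) ≡ d + 2
    cluster-size v deg≡ = sizes (count-not (adj H v)) (deg-complement G v) deg≡
      where
      sizes : ∀ {g h c} → h + c ≡ N → suc (g + h) ≡ N → g ≡ d + 1 → c ≡ d + 2
      sizes {g} {h} {c} refl eq refl = +-cancelˡ-≡ h c (d + 2) (trans (sym eq) (solve (d ∷ h ∷ [])))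

    outside-size : ∀ v → deg G v ≡ d + 1 → k ≤ deg H v
    outside-size v deg≡ = sizes (deg-complement G v) N≥ (≤-reflexive deg≡)
      where
      sizes : ∀ {g h} → suc (g + h) ≡ N → d + k + 2 ≤ N → g ≤ d + 1 → k ≤ h
      sizes {g} {h} refl p q = linear 0 (+-mono-≤ p q) (solve (d ∷ k ∷ g ∷ h ∷ []))

    3≤k : 3 ≤ k
    3≤k = s≤s⁻¹ (≤-trans 4≤d (≤-trans d≤k+1 (≤-reflexive (+-comm k 1))))

    cluster-join : ∀ v → deg G v ≡ d + 1 → ∀ w → 2 + k ≤ deg H w → Goal
    cluster-join v deg≡ = join-⊆ G k j∈ (cluster v) (cluster-cross v deg≡)
      (≤-trans (≤-trans (s≤s (s≤s (s≤s z≤n))) 4≤d) (≤-trans (m≤m+n d 2) (≤-reflexive (sym (cluster-size v deg≡)))))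
      (≤-trans (≤-trans 3≤k (outside-size v deg≡)) (count-mono (adj H v) (not ∘ cluster v) λ u vu → cong (not ∘ not) vu))
      k+6≤N

    codegree-of-low : N ≡ d + k + 3 → ∀ {w} → deg G w ≤ d → 2 + k ≤ deg H w
    codegree-of-low N≡ {w} low = bound (deg-complement G w) (≤-reflexive (sym N≡)) low
      where
      bound : ∀ {g h} → suc (g + h) ≡ N → d + k + 3 ≤ N → g ≤ d → 2 + k ≤ h
      bound {g} {h} refl p q = linear 0 (+-mono-≤ p q) (solve (g ∷ h ∷ d ∷ k ∷ []))

    -- No edge of `G` leaves a cluster, so lying in the cluster of one another is an equivalence
    -- relation with classes of size `d + 2`.
    all-clusters-∣ : (∀ v → deg G v ≡ d + 1) → d + 2 ∣ N
    all-clusters-∣ deg≡ = partition-∣ cluster (d + 2) (co-irr G)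
      (λ u w Cw → trans (cong not (adj-sym H w u)) Cw) transitive (λ u → cluster-size u (deg≡ u))
      where
      transitive : ∀ u w x → cluster u w ≡ true → cluster w x ≡ true → cluster u x ≡ true
      transitive u w x uw wx with bool-cases (cluster u x)
      ... | inj₁ ux = ux
      ... | inj₂ ux = ⊥-elim (not-true wx (cluster-cross u (deg≡ u) w x uw ux))

    -- `cluster-join` needs one vertex of `H`-degree at least `k + 2`. If n = m + 1, any vertex
    -- outside the cluster is `H`-adjacent to its `d + 2` elements. Otherwise a vertex of `G`-degree
    -- at most `d` will do; without one, `d + 2` divides `N`, which is `(d + 2) + (k + 1)`.
    medium-degree : k + 1 ≡ d ⊎ N ≡ d + k + 3 × ¬ (d + 2 ∣ k + 1) →
      (∀ u → deg G u ≤ d + 1) → ∀ v → deg G v ≡ d + 1 → Goal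
    medium-degree (inj₁ k+1≡d) _ v deg≡ =
      let (w , vw , _) = pick (adj H v) [] (≤-trans (≤-trans (s≤s z≤n) 3≤k) (outside-size v deg≡))
      in cluster-join v deg≡ w (begin
        2 + k             ≤⟨ n≤1+n (2 + k) ⟩
        3 + k             ≡⟨ cong (2 +_) (trans (+-comm 1 k) k+1≡d) ⟩
        2 + d             ≡⟨ trans (+-comm 2 d) (sym (cluster-size v deg≡)) ⟩
        count (cluster v) ≤⟨ count-mono (cluster v) (adj H w) (λ u Cu → adj-swap H (cluster-cross v deg≡ u w Cu (cong not vw))) ⟩
        deg H w           ∎)
      where open ≤-Reasoning
    medium-degree (inj₂ (N≡ , d+2∤k+1)) ≤d+1 v deg≡ with any? (λ w → deg G w ≤? d)
    ... | yes (w , low) = cluster-join v deg≡ w (codegree-of-low N≡ low)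
    ... | no none = ⊥-elim (d+2∤k+1 (∣m+n∣m⇒∣n (subst (d + 2 ∣_) (trans N≡ split) (all-clusters-∣ all-deg)) ∣-refl))
      where
      all-deg : ∀ u → deg G u ≡ d + 1
      all-deg u = ≤-antisym (≤d+1 u) (≤-trans (≤-reflexive (+-comm d 1)) (≰⇒> λ low → none (u , low)))
      split : d + k + 3 ≡ d + 2 + (k + 1)
      split = solve (d ∷ k ∷ [])

    -- On `d + k + 3` vertices every `H`-degree is at least `k + 2`. With one vertex fewer this
    -- needs a `G`-degree below `d`, which exists because `N * d` is odd and `G` therefore not
    -- `d`-regular.
    small-degree : N ≡ d + k + 3 ⊎ (N ≡ d + k + 2 × ¬ (2 ∣ N * d)) → (∀ u → deg G u ≤ d) → Goal
    small-degree (inj₁ N≡) ≤d =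
      let (v , _) = pick {N} (λ _ → true) [] (≤-trans (s≤s z≤n) (≤-trans (m≤n+m 6 k) (≤-trans k+6≤N (≤-reflexive (sym (count-true N))))))
      in LowDegree.low-degree-⊆ G d k 4≤d d≤k+1 N≥ ≤d v j∈ (codegree-of-low N≡ (≤d v))
    small-degree (inj₂ (N≡ , odd)) ≤d with any? (λ v → deg G v <? d)
    ... | yes (v , low) = LowDegree.low-degree-⊆ G d k 4≤d d≤k+1 N≥ ≤d v j∈ (bound (deg-complement G v) low)
      where
      bound : ∀ {g h} → suc (g + h) ≡ N → g < d → 2 + k ≤ h
      bound {g} {h} eq p = linear 0 (+-mono-≤ p (≤-reflexive (trans (sym N≡) (sym eq)))) (solve (g ∷ h ∷ d ∷ k ∷ []))
    ... | no none = ⊥-elim (odd (regular-even G d λ u → ≤-antisym (≤d u) (≮⇒≥ λ low → none (u , low))))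

  arrow : k + 1 ≡ d ⊎ N ≡ d + k + 3 × ¬ (d + 2 ∣ k + 1) → N ≡ d + k + 3 ⊎ (N ≡ d + k + 2 × ¬ (2 ∣ N * d)) →
    T′ (suc (suc (d + 1))) ⊆G G ⊎ Goal
  -- The search is for the hypotheses of `T′-⊆`; its failure is exactly `T′-free`.
  arrow sizes parity with any? (λ v → any? λ a → any? λ x →
      (adj G v a Bool.≟ true) ×-dec (adj G a x Bool.≟ true) ×-dec ¬? (x ≟ v) ×-dec (suc d ≤? count (adj G v ∖ x)))
  ... | yes (v , a , x , va , ax , x≢v , room) = inj₁ (T′-⊆ G d va ax x≢v room)
  ... | no none = inj₂ by-max-degree
    where
    T′-free : ∀ v a x → adj G v a ≡ true → adj G a x ≡ true → x ≢ v → count (adj G v ∖ x) ≤ d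
    T′-free v a x va ax x≢v = ≮⇒≥ λ room → none (v , a , x , va , ax , x≢v , room)

    by-max-degree : Goal
    by-max-degree with any? (λ v → d + 2 ≤? deg G v)
    ... | yes (v , large) = large-degree T′-free v large
    ... | no not-large with any? (λ v → deg G v ≟ℕ d + 1)
    ...   | yes (v , deg≡) = medium-degree T′-free sizes (λ u → ≤d+1 u) v deg≡
      where
      ≤d+1 : ∀ u → deg G u ≤ d + 1
      ≤d+1 u = s≤s⁻¹ (≤-trans (≰⇒> λ large → not-large (u , large)) (≤-reflexive (+-suc d 1)))
    ...   | no not-medium = small-degree T′-free parity λ u →
      s≤s⁻¹ (≤-trans (≤∧≢⇒< (s≤s⁻¹ (≤-trans (≰⇒> λ large → not-large (u , large)) (≤-reflexive (+-suc d 1)))) (λ eq → not-medium (u , eq)))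
        (≤-reflexive (+-comm d 1)))

-- Circulant graphs and their degrees.

sum-split : ∀ m {n} (f : Fin (m + n) → ℕ) → sum f ≡ sum (λ i → f (i ↑ˡ n)) + sum (λ j → f (m ↑ʳ j))
sum-split zero    f = refl
sum-split (suc m) f = trans (cong (f zero +_) (sum-split m (f ∘ suc))) (sym (+-assoc (f zero) _ _))

range-sum : ℕ → (ℕ → ℕ) → ℕ
range-sum n F = sum {n} (F ∘ toℕ)

range-sum-split : ∀ m n F → range-sum (m + n) F ≡ range-sum m F + range-sum n (λ t → F (m + t))
range-sum-split m n F = trans (sum-split m (F ∘ toℕ))
  (cong₂ _+_ (sum-cong-≗ {m} λ i → cong F (toℕ-↑ˡ i n)) (sum-cong-≗ {n} λ j → cong F (toℕ-↑ʳ m j)))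

range-sum-cong : ∀ n {F F′ : ℕ → ℕ} → (∀ t → t < n → F t ≡ F′ t) → range-sum n F ≡ range-sum n F′
range-sum-cong n F≡F′ = sum-cong-≗ λ i → F≡F′ (toℕ i) (toℕ<n i)

-- The interval from `a` to `p - a`, written without truncated subtraction.
inBand : ℕ → ℕ → ℕ → Bool
inBand a p t = (a ≤ᵇ t) ∧ (t + a ≤ᵇ p)

inBand-sound : ∀ {a p} t → inBand a p t ≡ true → a ≤ t × t + a ≤ p
inBand-sound {a} {p} t eq = let (l , u) = ∧-split eq in ≤ᵇ-sound a t l , ≤ᵇ-sound (t + a) p u

inBand-complete : ∀ {a p t} → a ≤ t → t + a ≤ p → inBand a p t ≡ true
inBand-complete l u = cong₂ _∧_ (≤ᵇ-complete l) (≤ᵇ-complete u)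

inBand-false : ∀ {a p t} → ¬ (a ≤ t × t + a ≤ p) → inBand a p t ≡ false
inBand-false {a} {p} {t} outside with bool-cases (inBand a p t)
... | inj₁ inside = ⊥-elim (outside (inBand-sound t inside))
... | inj₂ eq = eq

inBand-mirror : ∀ a s t → inBand a (s + t) s ≡ inBand a (s + t) t
inBand-mirror a s t = ⇔→≡ (mk⇔ (forth s t) (subst (λ p → inBand a p t ≡ true → inBand a p s ≡ true) (+-comm t s) (forth t s)))
  where
  forth : ∀ s t → inBand a (s + t) s ≡ true → inBand a (s + t) t ≡ true
  forth s t eq =
    let (a≤s , s+a≤s+t) = inBand-sound s eq
    in inBand-complete (+-cancelˡ-≤ s a t s+a≤s+t) (≤-trans (+-monoʳ-≤ t a≤s) (≤-reflexive (+-comm t s)))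

-- i and j are adjacent when b < |i − j| < p − b; the symmetry of this band under t ↦ p − t makes the graph circulant.
circulant : ∀ p b → Graph p
circulant p b = record
  { adj     = λ i j → inBand (suc b) p ∣ toℕ i - toℕ j ∣
  ; adj-sym = λ i j → cong (inBand (suc b) p) (∣-∣-comm (toℕ i) (toℕ j))
  ; adj-irr = λ i → cong (inBand (suc b) p) (∣n-n∣≡0 (toℕ i))
  }

-- Row `i` is a rotation of row 0: for `t` from `i` on, the distances run through 0 to `q - 1`, and
-- for `t < i` the mirror image of the distance `i - t` is `q + t`, which covers the rest.
band-rotate : ∀ a i q → range-sum (i + q) (λ t → ⟦ inBand a (i + q) ∣ i - t ∣ ⟧) ≡ range-sum (i + q) (λ t → ⟦ inBand a (i + q) t ⟧)
band-rotate a i q = begin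
  range-sum (i + q) (λ t → g ∣ i - t ∣)                                  ≡⟨ range-sum-split i q (λ t → g ∣ i - t ∣) ⟩
  range-sum i (λ t → g ∣ i - t ∣) + range-sum q (λ t → g ∣ i - i + t ∣)  ≡⟨ cong₂ _+_ (range-sum-cong i reflected) (range-sum-cong q λ t _ → cong g (∣m-m+n∣≡n i t)) ⟩
  range-sum i (λ t → g (q + t)) + range-sum q g                          ≡⟨ +-comm (range-sum i (λ t → g (q + t))) _ ⟩
  range-sum q g + range-sum i (λ t → g (q + t))                          ≡⟨ range-sum-split q i g ⟨
  range-sum (q + i) g                                                    ≡⟨ cong (λ p → range-sum p g) (+-comm q i) ⟩
  range-sum (i + q) g                                                    ∎
  where
  open ≡-Reasoning
  g : ℕ → ℕ
  g t = ⟦ inBand a (i + q) t ⟧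
  reflected : ∀ t → t < i → g ∣ i - t ∣ ≡ g (q + t)
  reflected t t<i = cong ⟦_⟧ (subst (λ p → inBand a p ∣ i - t ∣ ≡ inBand a p (q + t)) total (inBand-mirror a ∣ i - t ∣ (q + t)))
    where
    total : ∣ i - t ∣ + (q + t) ≡ i + q
    total = begin
      ∣ i - t ∣ + (q + t) ≡⟨ cong₂ _+_ (m≤n⇒∣n-m∣≡n∸m (<⇒≤ t<i)) (+-comm q t) ⟩
      i ∸ t + (t + q)     ≡⟨ +-assoc (i ∸ t) t q ⟨
      i ∸ t + t + q       ≡⟨ cong (_+ q) (m∸n+n≡m (<⇒≤ t<i)) ⟩
      i + q               ∎

-- The form of the modulus shows three blocks: `b + 1` values below the band, `d` inside it and `b`
-- above it.
band-size : ∀ b d → range-sum (suc b + (d + b)) (λ t → ⟦ inBand (suc b) (suc b + (d + b)) t ⟧) ≡ d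
band-size b d = begin
  range-sum p g                                      ≡⟨ range-sum-split (suc b) (d + b) g ⟩
  range-sum (suc b) g + range-sum (d + b) (λ t → g (suc b + t))
    ≡⟨ cong (range-sum (suc b) g +_) (range-sum-split d b (λ t → g (suc b + t))) ⟩
  range-sum (suc b) g + (range-sum d (λ t → g (suc b + t)) + range-sum b (λ t → g (suc b + (d + t))))
    ≡⟨ cong₂ _+_ (constant (suc b) 0 below) (cong₂ _+_ (constant d 1 inside) (constant b 0 above)) ⟩
  suc b * 0 + (d * 1 + b * 0)                        ≡⟨ solve (b ∷ d ∷ []) ⟩
  d                                                  ∎
  where
  open ≡-Reasoning
  p = suc b + (d + b)
  g : ℕ → ℕ
  g t = ⟦ inBand (suc b) p t ⟧
  constant : ∀ n c {F : ℕ → ℕ} → (∀ t → t < n → F t ≡ c) → range-sum n F ≡ n * c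
  constant n c F≡c = trans (range-sum-cong n F≡c) (sum-const n c)
  below : ∀ t → t < suc b → g t ≡ 0
  below t t<a = cong ⟦_⟧ (inBand-false λ (a≤t , _) → <⇒≱ t<a a≤t)
  inside : ∀ t → t < d → g (suc b + t) ≡ 1
  inside t t<d = cong ⟦_⟧ (inBand-complete (m≤m+n (suc b) t) (linear {b = suc b + (d + b)} 0 t<d (solve (b ∷ d ∷ t ∷ []))))
  above : ∀ t → t < b → g (suc b + (d + t)) ≡ 0
  above t _ = cong ⟦_⟧ (inBand-false {suc b} {p} {suc b + (d + t)} λ (_ , too-big) →
    case linear {suc b + (d + t) + suc b} {suc b + (d + b)} {1} {0} t too-big (solve (b ∷ d ∷ t ∷ [])) of λ ())

circulant-degree : ∀ b d i → deg (circulant (suc b + (d + b)) b) i ≡ d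
circulant-degree b d i = trans (rotate (suc b + (d + b)) (m+[n∸m]≡n (<⇒≤ (toℕ<n i)))) (band-size b d)
  where
  rotate : ∀ p {q} → toℕ i + q ≡ p →
    range-sum p (λ t → ⟦ inBand (suc b) p ∣ toℕ i - t ∣ ⟧) ≡ range-sum p (λ t → ⟦ inBand (suc b) p t ⟧)
  rotate _ {q} refl = band-rotate (suc b) (toℕ i) q

codegree : ∀ {p} (G : Graph p) {u d e} → p ≡ suc (d + e) → deg G u ≡ d → deg (complement G) u ≡ e
codegree G {u} {d} {e} p≡ refl = +-cancelˡ-≡ d _ e (ℕ-suc-injective (trans (deg-complement G u) p≡))

-- Disjoint unions with a complete graph.

empty : ∀ n → Graph n
empty n = record { adj = λ _ _ → false ; adj-sym = λ _ _ → refl ; adj-irr = λ _ → refl }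

complete : ∀ n → Graph n
complete n = complement (empty n)

isLeft : ∀ {A B : Set} → A ⊎ B → Bool
isLeft (inj₁ _) = true
isLeft (inj₂ _) = false

module _ {q r} (G₁ : Graph q) (G₂ : Graph r) where
  union-adj : Fin q ⊎ Fin r → Fin q ⊎ Fin r → Bool
  union-adj (inj₁ i) (inj₁ j) = adj G₁ i j
  union-adj (inj₂ i) (inj₂ j) = adj G₂ i j
  union-adj (inj₁ _) (inj₂ _) = false
  union-adj (inj₂ _) (inj₁ _) = false

  union-adj-sym : ∀ s t → union-adj s t ≡ union-adj t s
  union-adj-sym (inj₁ i) (inj₁ j) = adj-sym G₁ i j
  union-adj-sym (inj₂ i) (inj₂ j) = adj-sym G₂ i j
  union-adj-sym (inj₁ _) (inj₂ _) = refl
  union-adj-sym (inj₂ _) (inj₁ _) = refl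

  union-adj-irr : ∀ s → union-adj s s ≡ false
  union-adj-irr (inj₁ i) = adj-irr G₁ i
  union-adj-irr (inj₂ i) = adj-irr G₂ i

  union : Graph (q + r)
  union = record
    { adj     = λ i j → union-adj (splitAt q i) (splitAt q j)
    ; adj-sym = λ i j → union-adj-sym (splitAt q i) (splitAt q j)
    ; adj-irr = λ i → union-adj-irr (splitAt q i)
    }

  union-same-side : ∀ s t → union-adj s t ≡ true → isLeft s ≡ isLeft t
  union-same-side (inj₁ _) (inj₁ _) _ = refl
  union-same-side (inj₂ _) (inj₂ _) _ = refl

  union-degreeʳ : ∀ {u i} → splitAt q u ≡ inj₂ i → deg union u ≡ deg G₂ i
  union-degreeʳ {u} {i} eq rewrite eq = trans (sum-split q _)
    (cong₂ _+_ (trans (sum-cong-≗ λ j → cong (⟦_⟧ ∘ union-adj (inj₂ i)) (splitAt-↑ˡ q j r)) (trans (sum-const q 0) (*-zeroʳ q)))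
               (sum-cong-≗ λ j → cong (⟦_⟧ ∘ union-adj (inj₂ i)) (splitAt-↑ʳ q r j)))

leftPart : ∀ q {r} → Pred (q + r)
leftPart q u = isLeft (splitAt q u)

leftPart-count : ∀ q {r} → count (leftPart q {r}) ≡ q
leftPart-count q {r} = trans (sum-split q _) (trans (cong₂ _+_
  (trans (sum-cong-≗ λ j → cong (⟦_⟧ ∘ isLeft) (splitAt-↑ˡ q j r)) (count-true q))
  (trans (sum-cong-≗ λ j → cong (⟦_⟧ ∘ isLeft) (splitAt-↑ʳ q r j)) (trans (sum-const r 0) (*-zeroʳ r))))
  (+-identityʳ q))

rightPart-count : ∀ q {r} → count (not ∘ leftPart q {r}) ≡ r
rightPart-count q {r} = +-cancelˡ-≡ q _ r
  (trans (cong (_+ count (not ∘ leftPart q {r})) (sym (leftPart-count q {r}))) (count-not (leftPart q {r})))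

-- A vertex of the clique is adjacent to all other vertices on its side, so its neighbours in the
-- complement are among the `r` on the right.
complete-union-codegree : ∀ {q r} (G : Graph r) u i → splitAt q u ≡ inj₁ i →
  deg (complement (union (complete q) G)) u ≤ r
complete-union-codegree {q} {r} G u i eq =
  ≤-trans (count-mono _ _ far) (≤-reflexive (rightPart-count q))
  where
  U = union (complete q) G
  far : ∀ w → adj (complement U) u w ≡ true → not (leftPart q w) ≡ true
  far w uw = go (splitAt q w) refl
    where
    go : ∀ s → splitAt q w ≡ s → not (isLeft s) ≡ true
    go (inj₂ _) _   = refl
    go (inj₁ j) eq′ = ⊥-elim (true≢false
      (trans (cong₂ (union-adj (complete q) G) eq eq′)
        (co-intro (empty q) (λ { refl → adj-≢ (complement U) uw (trans (sym (splitAt⁻¹-↑ˡ eq)) (splitAt⁻¹-↑ˡ eq′)) }) refl))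
      (co-elim U uw))

-- Obstructions to containing the trees.

star-degree : ∀ {s t n} (G : Graph n) (e : ℕ → ℕ → Bool) → t ≤ s → (∀ b → 1 ≤ b → b ≤ t → e 0 b ≡ true) →
  ((f , _) : mkGraph (suc s) e ⊆G G) → t ≤ deg G (f zero)
star-degree {s} {t} G e t≤s spoke (f , f-inj , hom) =
  injection-count (adj G (f zero)) (λ i → f (suc (inject≤ i t≤s)))
    (λ {i} {j} eq → inject≤-injective t≤s t≤s i j (suc-injective (f-inj eq)))
    (λ i → hom zero (suc (inject≤ i t≤s)) (mkGraph-adj e zero (suc (inject≤ i t≤s)) (λ ())
      (spoke _ (s≤s z≤n) (subst (_< t) (sym (toℕ-inject≤ i t≤s)) (toℕ<n i)))))

∨-introˡ : ∀ {a} b → a ≡ true → a ∨ b ≡ true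
∨-introˡ b refl = refl

T′-degree : ∀ {n d} (G : Graph n) ((f , _) : T′ (suc (suc (d + 1))) ⊆G G) → d + 1 ≤ deg G (f zero)
T′-degree {d = d} G = star-degree G (E′ (suc (suc (d + 1)))) (n≤1+n (d + 1))
  λ b 1≤b b≤ → ∨-introˡ _ (starE-complete 1≤b b≤)

T-degree : ∀ {n j k} (H : Graph n) → j ≡ 1 ⊎ j ≡ 2 → ((f , _) : T j (suc (k + 4)) ⊆G H) → k + 2 ≤ deg H (f zero)
T-degree {k = k} H = λ
  { (inj₁ refl) → star-degree H (E¹ (suc (k + 4))) k+2≤k+4 λ b 1≤b b≤ → ∨-introˡ _ (spoke b 1≤b b≤)
  ; (inj₂ refl) → star-degree H (E² (suc (k + 4))) k+2≤k+4 λ b 1≤b b≤ → ∨-introˡ _ (spoke b 1≤b b≤) }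
  where
  k+2≤k+4 : k + 2 ≤ k + 4
  k+2≤k+4 = +-monoʳ-≤ k (s≤s (s≤s z≤n))
  spoke : ∀ b → 1 ≤ b → b ≤ k + 2 → starE (k + 4 ∸ 2) 0 b ≡ true
  spoke b 1≤b b≤ = starE-complete 1≤b (≤-trans b≤ (≤-reflexive (sym (+-∸-assoc k {4} {2} (s≤s (s≤s z≤n))))))

T′⊈low-degree : ∀ {n d} (G : Graph n) → (∀ u → deg G u ≤ d) → ¬ (T′ (suc (suc (d + 1))) ⊆G G)
T′⊈low-degree {d = d} G low emb = <⇒≱ (≤-reflexive (+-comm 1 d)) (≤-trans (T′-degree G emb) (low (proj₁ emb zero)))

T⊈low-degree : ∀ {n j k} (H : Graph n) → j ≡ 1 ⊎ j ≡ 2 → (∀ u → deg H u ≤ k + 1) → ¬ (T j (suc (k + 4)) ⊆G H)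
T⊈low-degree {k = k} H j∈ low emb = <⇒≱ (≤-reflexive (sym (+-suc k 1))) (≤-trans (T-degree H j∈ emb) (low (proj₁ emb zero)))

-- On the right the degrees are too small for the centre. If the centre lands in the clique,
-- connectedness puts all `d + 3` vertices of the tree there, but the clique has only `d + 2`.
T′⊈complete-union : ∀ {r d} (G : Graph r) → (∀ u → deg G u ≤ d) → ¬ (T′ (suc (suc (d + 1))) ⊆G union (complete (d + 2)) G)
T′⊈complete-union {r} {d} G low emb@(f , f-inj , hom) with splitAt (d + 2) (f zero) in eq
... | inj₂ i = <⇒≱ (≤-reflexive (+-comm 1 d))
  (≤-trans (T′-degree U emb) (≤-trans (≤-reflexive (union-degreeʳ (complete (d + 2)) G {f zero} eq)) (low i)))
  where U = union (complete (d + 2)) G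
... | inj₁ i = <⇒≱ (≤-reflexive (cong suc (+-suc d 1)))
  (≤-trans (injection-count (leftPart (d + 2)) f f-inj inside) (≤-reflexive (leftPart-count (d + 2) {r})))
  where
  U = union (complete (d + 2)) G
  e = E′ (suc (suc (d + 1)))
  along : ∀ {a b} → a ≢ b → e (toℕ a) (toℕ b) ≡ true → leftPart (d + 2) (f a) ≡ true → leftPart (d + 2) (f b) ≡ true
  along {a} {b} a≢b eₐᵦ left = trans
    (sym (union-same-side (complete (d + 2)) G (splitAt (d + 2) (f a)) (splitAt (d + 2) (f b)) (hom a b (mkGraph-adj e a b a≢b eₐᵦ)))) left
  centre : leftPart (d + 2) (f zero) ≡ true
  centre = cong isLeft eq
  spoke : ∀ b → 1 ≤ toℕ b → toℕ b ≤ d + 1 → leftPart (d + 2) (f b) ≡ true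
  spoke b 1≤b b≤ = along {zero} {b} (λ { refl → case 1≤b of λ () }) (∨-introˡ _ (starE-complete 1≤b b≤)) centre
  inside : ∀ b → leftPart (d + 2) (f b) ≡ true
  inside zero = centre
  inside (suc b) with m≤n⇒m<n∨m≡n (s≤s⁻¹ (toℕ<n (suc b)))
  ... | inj₁ b< = spoke (suc b) (s≤s z≤n) (s≤s⁻¹ b<)
  -- The last vertex is not a spoke and is reached through v₁.
  ... | inj₂ b≡ = along {suc zero} {suc b} (λ eq → <⇒≢ (≤-trans (s≤s (m≤n+m 1 d)) (≤-reflexive (sym b≡))) (cong toℕ eq))
    (cong (λ c → starE (d + 1) 1 (toℕ (suc b)) ∨ c) (≡ᵇ-complete b≡)) (spoke (suc zero) (s≤s z≤n) (m≤n+m 1 d))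

-- Monotonicity of arrowing.

restrict : ∀ {m n} → m ≤ n → Graph n → Graph m
restrict m≤n G = record
  { adj     = λ i j → adj G (inject≤ i m≤n) (inject≤ j m≤n)
  ; adj-sym = λ i j → adj-sym G _ _
  ; adj-irr = λ i → adj-irr G _
  }

-- Apply the hypothesis to the subgraph induced on the first `m` vertices; taking complements
-- commutes with this restriction.
arrows-mono : ∀ {a b m n} (A : Graph a) (B : Graph b) → m ≤ n → Arrows m A B → Arrows n A B
arrows-mono {m = m} A B m≤n arrows G with arrows (restrict m≤n G)
... | inj₁ (f , f-inj , hom) = inj₁ ((λ i → inject≤ (f i) m≤n) , (λ {i} {j} eq → f-inj (inject≤-injective m≤n m≤n (f i) (f j) eq)) , hom)
... | inj₂ (f , f-inj , hom) = inj₂ ((λ i → inject≤ (f i) m≤n) , (λ {i} {j} eq → f-inj (inject≤-injective m≤n m≤n (f i) (f j) eq)) , co-hom)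
  where
  R = restrict m≤n G
  co-hom : ∀ i j → adj B i j ≡ true → adj (complement G) (inject≤ (f i) m≤n) (inject≤ (f j) m≤n) ≡ true
  co-hom i j ij = co-intro G (adj-≢ (complement R) (hom i j ij) ∘ inject≤-injective m≤n m≤n _ _) (co-elim R (hom i j ij))

ramsey : ∀ {a b p} (A : Graph a) (B : Graph b) → Arrows (suc p) A B → ¬ Arrows p A B → RamseyNumber A B (suc p)
ramsey A B upper lower = s≤s z≤n , upper , λ M _ M≤p arrows → lower (arrows-mono A B (s≤s⁻¹ M≤p) arrows)

-- Lower bound constructions.

half : ∀ n → ∃ λ b → n ≡ 2 * b ⊎ n ≡ suc (2 * b)
half zero = 0 , inj₁ refl
half (suc n) with half n
... | b , inj₁ eq = b , inj₂ (cong suc eq)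
... | b , inj₂ eq = suc b , inj₁ (trans (cong suc eq) (solve (b ∷ [])))

module Lower {j} (j∈ : j ≡ 1 ⊎ j ≡ 2) (d k : ℕ) where
  NonArrow : ℕ → Set
  NonArrow p = ¬ Arrows p (T′ (suc (suc (d + 1)))) (T j (suc (k + 4)))

  regular : ∀ {p} (G : Graph p) → (∀ u → deg G u ≤ d) → (∀ u → deg (complement G) u ≤ k + 1) → NonArrow p
  regular G low colow arrows with arrows G
  ... | inj₁ emb = T′⊈low-degree G low emb
  ... | inj₂ emb = T⊈low-degree {k = k} (complement G) j∈ colow emb

  circulant-lower : ∀ b → 2 * b ≤ k + 1 → NonArrow (suc b + (d + b))
  circulant-lower b 2b≤k+1 = regular C (λ u → ≤-reflexive (degree u))
    (λ u → ≤-trans (≤-reflexive (codegree C {u} {d} {2 * b} (solve (b ∷ d ∷ [])) (degree u))) 2b≤k+1)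
    where
    C = circulant (suc b + (d + b)) b
    degree = circulant-degree b d

  co-circulant-lower : ∀ b → d ≡ 2 * b → NonArrow (suc b + (k + 1 + b))
  co-circulant-lower b refl = regular (complement C) (λ u → ≤-reflexive (co u))
    (λ u → ≤-reflexive (codegree (complement C) {u} {2 * b} {k + 1} (solve (b ∷ k ∷ [])) (co u)))
    where
    C = circulant (suc b + (k + 1 + b)) b
    co : ∀ u → deg (complement C) u ≡ 2 * b
    co u = codegree C {u} {k + 1} {2 * b} (solve (b ∷ k ∷ [])) (circulant-degree b (k + 1) u)

  union-lower : ∀ b → k ≡ suc b + (d + b) → NonArrow (d + 2 + k)
  union-lower b refl arrows with arrows (union (complete (d + 2)) C)
    where C = circulant (suc b + (d + b)) b
  ... | inj₁ emb = T′⊈complete-union C (λ u → ≤-reflexive (circulant-degree b d u)) emb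
    where C = circulant (suc b + (d + b)) b
  ... | inj₂ emb = T⊈low-degree {k = suc b + (d + b)} (complement U) j∈ colow emb
    where
    C = circulant (suc b + (d + b)) b
    U = union (complete (d + 2)) C
    colow : ∀ u → deg (complement U) u ≤ k + 1
    colow u = go (splitAt (d + 2) u) refl
      where
      size : ∀ d k → d + 2 + k ≡ suc (d + (k + 1))
      size = solve-∀
      go : ∀ s → splitAt (d + 2) u ≡ s → deg (complement U) u ≤ k + 1
      go (inj₁ i) eq = ≤-trans (complete-union-codegree C u i eq) (m≤m+n k 1)
      go (inj₂ i) eq = ≤-reflexive (codegree U {u} {d} {k + 1} (size d k)
        (trans (union-degreeʳ (complete (d + 2)) C {u} eq) (circulant-degree b d i)))

  -- Degrees at most `d` and codegrees at most `k + 1` on `d + k + 2` vertices force a `d`-regular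
  -- graph. For odd `k` it is a circulant; for `k` and `d` even, the complement of one. For `k` even
  -- and `d` odd no such graph exists, and the union with a clique takes over.
  lower : d ≤ k + 1 → (∃ λ b → d ≡ 2 * b) ⊎ d ≤ k → NonArrow (d + k + 2)
  lower d≤k+1 even-or-≤ with half k
  ... | b , inj₂ refl = subst NonArrow (size b d) (circulant-lower (suc b) (≤-reflexive (solve (b ∷ []))))
    where
    size : ∀ b d → suc (suc b) + (d + suc b) ≡ d + suc (2 * b) + 2
    size = solve-∀
  ... | c , inj₁ k≡2c with half d
  ...   | b , inj₁ refl = subst NonArrow (size b k) (co-circulant-lower b refl)
    where
    size : ∀ b k → suc b + (k + 1 + b) ≡ 2 * b + k + 2
    size = solve-∀
  ...   | b , inj₂ refl with even-or-≤
  ...     | inj₁ (b′ , odd≡even) = ⊥-elim (even≢odd b′ b (sym odd≡even))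
  -- The width `c - b - 1` makes the `d`-regular circulant have exactly `k` vertices.
  ...     | inj₂ d≤k = subst NonArrow (size d k) (union-lower (c ∸ suc b) (trans k≡2c (width (c ∸ suc b) (m+[n∸m]≡n b<c))))
    where
    size : ∀ d k → d + 2 + k ≡ d + k + 2
    size = solve-∀
    b<c : b < c
    b<c = *-cancelˡ-< 2 b c (≤-trans d≤k (≤-reflexive k≡2c))
    width : ∀ a → suc b + a ≡ c → 2 * c ≡ suc a + (suc (2 * b) + a)
    width a refl = solve (a ∷ b ∷ [])

-- The Ramsey numbers.

ramsey-tall : ∀ {j} → j ≡ 1 ⊎ j ≡ 2 → ∀ d k → 4 ≤ d → d ≤ k + 1 →
  k + 1 ≡ d × (∃ λ b → d ≡ 2 * b) ⊎ d ≤ k × ¬ (d + 2 ∣ k + 1) →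
  RamseyNumber (T′ (suc (suc (d + 1)))) (T j (suc (k + 4))) (suc (d + k + 2))
-- The value `d + k + 3` is m + n - 5. The alternatives in `sizes` are n = m + 1 with m odd, and n ≥
-- m + 2 with the divisibility hypothesis.
ramsey-tall {j} j∈ d k 4≤d d≤k+1 sizes = ramsey (T′ _) (T j _)
  (λ G → Upper.arrow G d k j∈ 4≤d d≤k+1 (n≤1+n _) (Sum.map proj₁ (λ (_ , ∤) → suc-size , ∤) sizes) (inj₁ suc-size))
  (Lower.lower j∈ d k d≤k+1 (Sum.map proj₂ proj₁ sizes))
  where
  suc-size : suc (d + k + 2) ≡ d + k + 3
  suc-size = solve (d ∷ k ∷ [])

-- This is n = m + 1 with m even, where `d` is `k + 1` and odd. Parity rules out a `d`-regular graph
-- on `d + k + 2` vertices; with one vertex fewer a `d`-regular circulant exists, and its complement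
-- has degree `k`.
ramsey-short : ∀ {j} → j ≡ 1 ⊎ j ≡ 2 → ∀ k b → 4 ≤ k + 1 → k ≡ 2 * b →
  RamseyNumber (T′ (suc (suc (k + 1 + 1)))) (T j (suc (k + 4))) (suc (k + 1 + k + 1))
ramsey-short {j} j∈ _ b 4≤k+1 refl = ramsey (T′ _) (T j _)
  (λ G → Upper.arrow G (k + 1) k j∈ 4≤k+1 ≤-refl (≤-reflexive total) (inj₁ refl) (inj₂ (sym total , odd)))
  (subst (Lower.NonArrow j∈ (k + 1) k) (size b) (Lower.circulant-lower j∈ (k + 1) k b (m≤m+n k 1)))
  where
  k = 2 * b
  total : k + 1 + k + 2 ≡ suc (k + 1 + k + 1)
  total = +-suc (k + 1 + k) 1
  size : ∀ b → suc b + (2 * b + 1 + b) ≡ 2 * b + 1 + 2 * b + 1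
  size = solve-∀
  -- The order `4 * b + 3` and the degree `2 * b + 1` are both odd.
  product : ∀ b → suc (2 * b + 1 + 2 * b + 1) * (2 * b + 1) ≡ suc (2 * (4 * b * b + 5 * b + 1))
  product = solve-∀
  odd : ¬ (2 ∣ suc (k + 1 + k + 1) * (k + 1))
  odd (divides c eq) = even≢odd c (4 * b * b + 5 * b + 1) (trans (*-comm 2 c) (trans (sym eq) (product b)))

add⇒monus : ∀ c {x y} → c + x ≡ y → x ≡ y ∸ c
add⇒monus c {x} refl = sym (m+n∸m≡n c x)

-- Stated for variables so that the three index equations can be matched with `refl`.
transport : ∀ {j m m′ n n′ N N′} → m′ ≡ m → n′ ≡ n → N′ ≡ N →
  RamseyNumber (T′ m′) (T j n′) N′ → RamseyNumber (T′ m) (T j n) N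
transport refl refl refl r = r

ramsey-odd : ∀ {j} → j ≡ 1 ⊎ j ≡ 2 → ∀ e → let m = suc (2 * (4 + e)) in RamseyNumber (T′ m) (T j (m + 1)) (2 * m ∸ 4)
ramsey-odd {j} j∈ e = transport {j} m-eq n-eq (add⇒monus 4 N-eq)
  -- The parameters are `m - 3` and `n - 5` for `m = 9 + 2 * e` and `n = m + 1`.
  (ramsey-tall j∈ (6 + 2 * e) (5 + 2 * e) (m≤m+n 4 (2 + 2 * e)) (≤-reflexive d-eq) (inj₁ (sym d-eq , 3 + e , half-eq)))
  where
  m-eq : 2 + (6 + 2 * e + 1) ≡ suc (2 * (4 + e))
  m-eq = solve (e ∷ [])
  n-eq : 1 + (5 + 2 * e + 4) ≡ suc (2 * (4 + e)) + 1
  n-eq = solve (e ∷ [])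
  N-eq : 4 + suc (6 + 2 * e + (5 + 2 * e) + 2) ≡ 2 * suc (2 * (4 + e))
  N-eq = solve (e ∷ [])
  d-eq : 6 + 2 * e ≡ 5 + 2 * e + 1
  d-eq = solve (e ∷ [])
  half-eq : 6 + 2 * e ≡ 2 * (3 + e)
  half-eq = solve (e ∷ [])

ramsey-even : ∀ {j} → j ≡ 1 ⊎ j ≡ 2 → ∀ e → let m = 2 * (8 + e) in RamseyNumber (T′ m) (T j (m + 1)) (2 * m ∸ 5)
ramsey-even {j} j∈ e = transport {j} m-eq n-eq (add⇒monus 5 N-eq)
  (ramsey-short j∈ (2 * (6 + e)) (6 + e) (≤-trans (*-monoʳ-≤ 2 (m≤m+n 2 (4 + e))) (m≤m+n _ 1)) refl)
  where
  m-eq : 2 + (2 * (6 + e) + 1 + 1) ≡ 2 * (8 + e)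
  m-eq = solve (e ∷ [])
  n-eq : 1 + (2 * (6 + e) + 4) ≡ 2 * (8 + e) + 1
  n-eq = solve (e ∷ [])
  N-eq : 5 + suc (2 * (6 + e) + 1 + 2 * (6 + e) + 1) ≡ 2 * (2 * (8 + e))
  N-eq = solve (e ∷ [])

ramsey-general : ∀ {j} → j ≡ 1 ⊎ j ≡ 2 → ∀ e o → let m = 7 + e ; n = 7 + e + 2 + o in
  ¬ ((m ∸ 1) ∣ (n ∸ 4)) → RamseyNumber (T′ m) (T j n) (m + n ∸ 5)
ramsey-general {j} j∈ e o ∤ = transport {j} m-eq n-eq (add⇒monus 5 N-eq)
  (ramsey-tall j∈ (4 + e) (4 + e + o) (m≤m+n 4 e) (≤-trans (m≤m+n (4 + e) o) (m≤m+n _ 1))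
    (inj₂ (m≤m+n (4 + e) o , λ d∣ → ∤ (subst₂ _∣_ (+-comm (4 + e) 2) size d∣))))
  where
  m-eq : 2 + (4 + e + 1) ≡ 7 + e
  m-eq = solve (e ∷ [])
  n-eq : 1 + (4 + e + o + 4) ≡ 7 + e + 2 + o
  n-eq = solve (e ∷ o ∷ [])
  N-eq : 5 + suc (4 + e + (4 + e + o) + 2) ≡ 7 + e + (7 + e + 2 + o)
  N-eq = solve (e ∷ o ∷ [])
  size : 4 + e + o + 1 ≡ 3 + (e + 2 + o)
  size = solve (e ∷ o ∷ [])

theorem6p3 : (m : ℕ) → 1 ≤ m → (j : ℕ) → (j ≡ 1 ⊎ j ≡ 2) →
    ((Odd m → 9 ≤ m → RamseyNumber (T′ m) (T j (m + 1)) (2 * m ∸ 4))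
    × (Even m → 16 ≤ m → RamseyNumber (T′ m) (T j (m + 1)) (2 * m ∸ 5)))
    × ((n : ℕ) → 1 ≤ n → 7 ≤ m → m + 2 ≤ n → 19 ∸ m ≤ n → ¬ ((m ∸ 1) ∣ (n ∸ 4)) →
    RamseyNumber (T′ m) (T j n) (m + n ∸ 5))
theorem6p3 m _ j j∈ = (odd , even) , general
  where
  odd : Odd m → 9 ≤ m → RamseyNumber (T′ m) (T j (m + 1)) (2 * m ∸ 4)
  odd (c , refl) 9≤m with m≤n⇒∃[o]m+o≡n {4} {c} (*-cancelˡ-≤ 2 (s≤s⁻¹ 9≤m))
  ... | e , refl = ramsey-odd j∈ e

  even : Even m → 16 ≤ m → RamseyNumber (T′ m) (T j (m + 1)) (2 * m ∸ 5)
  even (c , refl) 16≤m with m≤n⇒∃[o]m+o≡n {8} {c} (*-cancelˡ-≤ 2 16≤m)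
  ... | e , refl = ramsey-even j∈ e

  general : (n : ℕ) → 1 ≤ n → 7 ≤ m → m + 2 ≤ n → 19 ∸ m ≤ n → ¬ ((m ∸ 1) ∣ (n ∸ 4)) →
    RamseyNumber (T′ m) (T j n) (m + n ∸ 5)
  general n _ 7≤m m+2≤n _ ∤ with m≤n⇒∃[o]m+o≡n 7≤m | m≤n⇒∃[o]m+o≡n m+2≤n
  ... | e , refl | o , refl = ramsey-general j∈ e o ∤
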